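{- For all integers $t,r \geq 1$ and every real $0 < \varepsilon < \frac{1}{r+2}$, there exists an edge-weighted graph of treewidth at most $2t+2$ that induces a metric of $\varepsilon$-scatter dimension at least $2^{\binom{t+r}{t}}$.
   Context: An edge-weighted graph is a finite simple graph $G$ with a nonnegative real weight on each edge. The metric induced by $G$ is $(V(G),\mathrm{dist})$, where $\mathrm{dist}(x,y)$ is the minimum total weight of a path from $x$ to $y$ in $G$. For a metric space $(V,\mathrm{dist})$ and $\varepsilon>0$, an $\varepsilon$-ladder is a sequence $(x_i,p_i)_{i=1}^\ell$ of pairs of points of $V$ such that for some real $\varrho>0$ (its width): $\mathrm{dist}(p_j,x_i) \leq \varrho$ for all $1 \leq j < i \leq \ell$, and $\mathrm{dist}(p_i,x_i) > (1+\varepsilon) \varrho$ for all $1 \leq i \leq \ell$. The number $\ell$ is its length. The $\varepsilon$-scatter dimension of $(V,\mathrm{dist})$ is the length of the longest $\varepsilon$-ladder in it. Treewidth is the usual graph parameter (minimum over tree decompositions of the maximum bag size minus one). -}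

module Defs where

open import Data.Fin.Base using (Fin) renaming (_<_ to _<ᶠ_)
open import Data.Fin.Subset using (Subset; _∈_; ∣_∣)
open import Data.List.Base using (List; []; _∷_; length; tabulate)
open import Data.List.Extrema.Nat using (max)
open import Data.List.Relation.Unary.All using (All)
open import Data.List.Relation.Unary.Unique.Propositional using (Unique)
open import Data.Nat.Base as ℕ using (ℕ; _∸_; _⊔_)
import Data.Nat.Properties as ℕₚ
open import Data.Product.Base using (∃-syntax; Σ-syntax; _×_; _,_; proj₁; proj₂)
open import Data.Rational.Base as ℚ
  using (ℚ; 0ℚ; 1ℚ; ½; _+_; _-_; _*_; 1/_; Positive; NonZero; positive; nonNegative)
  renaming (∣_∣ to ∣_∣ℚ)
import Data.Rational.Properties as ℚₚ
open import Data.Rational.Solver using (module +-*-Solver)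
open import Function.Bundles using (_⇔_; mk⇔)
open import Function.Metric.Structures using (IsGeneralMetric)
open import Level using (0ℓ)
open import Relation.Binary.Core using (Rel)
open import Relation.Binary.Construct.Closure.ReflexiveTransitive
  using (Star; _◅_) renaming (ε to stop)
open import Relation.Binary.Definitions using (Decidable; Irreflexive; Symmetric)
open import Relation.Binary.PropositionalEquality
  using (_≡_; refl; sym; trans; cong; cong₂; subst)
open import Relation.Nullary.Negation using (¬_)

------------------------------------------------------------------------
-- Real numbers, as Cauchy sequences of rationals up to _≈ᴿ_

IsCauchy : (ℕ → ℚ) → Set
IsCauchy s = ∀ δ → 0ℚ ℚ.< δ →
  ∃[ N ] ∀ m n → N ℕ.≤ m → N ℕ.≤ n → ∣ s m - s n ∣ℚ ℚ.< δ

record ℝ : Set where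
  constructor mkℝ
  field
    seq    : ℕ → ℚ
    cauchy : IsCauchy seq

open ℝ public

infix  4 _≈ᴿ_ _≤ᴿ_ _<ᴿ_
infixl 6 _+ᴿ_
infixl 7 _*ᴿ_

_≈ᴿ_ : Rel ℝ 0ℓ
x ≈ᴿ y = ∀ δ → 0ℚ ℚ.< δ →
  ∃[ N ] ∀ n → N ℕ.≤ n → ∣ seq x n - seq y n ∣ℚ ℚ.< δ

_≤ᴿ_ : Rel ℝ 0ℓ
x ≤ᴿ y = ∀ δ → 0ℚ ℚ.< δ →
  ∃[ N ] ∀ n → N ℕ.≤ n → seq x n ℚ.≤ seq y n + δ

-- The gap δ must be uniform: an eventual termwise strict inequality would
-- not respect _≈ᴿ_.
_<ᴿ_ : Rel ℝ 0ℓ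
x <ᴿ y = Σ[ δ ∈ ℚ ] 0ℚ ℚ.< δ ×
  (∃[ N ] ∀ n → N ℕ.≤ n → seq x n + δ ℚ.≤ seq y n)

fromℚ : ℚ → ℝ
fromℚ q = mkℝ (λ _ → q) λ δ 0<δ → 0 , λ _ _ _ _ →
  subst (ℚ._< δ) (sym (cong ∣_∣ℚ (ℚₚ.+-inverseʳ q))) 0<δ

0ᴿ 1ᴿ : ℝ
0ᴿ = fromℚ 0ℚ
1ᴿ = fromℚ 1ℚ

private
  -- abstract: unfolding these proofs makes type checking very slow.
  abstract
    half : ℚ → ℚ
    half δ = ½ * δ

    half-pos : ∀ {δ} → 0ℚ ℚ.< δ → 0ℚ ℚ.< half δ
    half-pos {δ} 0<δ = subst (ℚ._< half δ) (ℚₚ.*-zeroʳ ½) (ℚₚ.*-monoʳ-<-pos ½ {0ℚ} {δ} 0<δ)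

    half+half : ∀ δ → half δ + half δ ≡ δ
    half+half δ = trans (sym (ℚₚ.*-distribʳ-+ δ ½ ½)) (ℚₚ.*-identityˡ δ)

    +-close : ∀ {δ} a b c d → ∣ a - c ∣ℚ ℚ.< half δ → ∣ b - d ∣ℚ ℚ.< half δ →
              ∣ (a + b) - (c + d) ∣ℚ ℚ.< δ
    +-close {δ} a b c d a-c b-d = begin-strict
      ∣ (a + b) - (c + d) ∣ℚ      ≡⟨ cong ∣_∣ℚ (rearrange a b c d) ⟩
      ∣ (a - c) + (b - d) ∣ℚ      ≤⟨ ℚₚ.∣p+q∣≤∣p∣+∣q∣ (a - c) (b - d) ⟩
      ∣ a - c ∣ℚ + ∣ b - d ∣ℚ     <⟨ ℚₚ.+-mono-< a-c b-d ⟩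
      half δ + half δ             ≡⟨ half+half δ ⟩
      δ ∎
      where
      open ℚₚ.≤-Reasoning
      rearrange : ∀ w x y z → (w + x) - (y + z) ≡ (w - y) + (x - z)
      rearrange = solve 4 (λ w x y z → (w :+ x) :- (y :+ z) := (w :- y) :+ (x :- z)) refl
        where open +-*-Solver

    +-cauchy : ∀ s u → IsCauchy s → IsCauchy u → IsCauchy (λ n → s n + u n)
    +-cauchy s u cs cu δ 0<δ with cs (half δ) (half-pos 0<δ) | cu (half δ) (half-pos 0<δ)
    ... | M , fM | N , fN = M ⊔ N , λ m n p q →
      +-close (s m) (u m) (s n) (u n)
        (fM m n (ℕₚ.m⊔n≤o⇒m≤o M N p) (ℕₚ.m⊔n≤o⇒m≤o M N q))
        (fN m n (ℕₚ.m⊔n≤o⇒n≤o M N p) (ℕₚ.m⊔n≤o⇒n≤o M N q))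

    near⇒bounded : ∀ p q → ∣ p - q ∣ℚ ℚ.< 1ℚ → ∣ p ∣ℚ ℚ.≤ 1ℚ + ∣ q ∣ℚ
    near⇒bounded p q near = begin
      ∣ p ∣ℚ                 ≡⟨ cong ∣_∣ℚ (add-sub p q) ⟩
      ∣ (p - q) + q ∣ℚ       ≤⟨ ℚₚ.∣p+q∣≤∣p∣+∣q∣ (p - q) q ⟩
      ∣ p - q ∣ℚ + ∣ q ∣ℚ    ≤⟨ ℚₚ.+-monoˡ-≤ ∣ q ∣ℚ (ℚₚ.<⇒≤ near) ⟩
      1ℚ + ∣ q ∣ℚ ∎
      where
      open ℚₚ.≤-Reasoning
      add-sub : ∀ a b → a ≡ (a - b) + b
      add-sub = solve 2 (λ a b → a := (a :- b) :+ b) refl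
        where open +-*-Solver

    bounded : ∀ s → IsCauchy s →
      Σ[ B ∈ ℚ ] 0ℚ ℚ.< B × (∃[ N ] ∀ n → N ℕ.≤ n → ∣ s n ∣ℚ ℚ.≤ B)
    bounded s cs with cs 1ℚ (ℚₚ.positive⁻¹ 1ℚ)
    ... | N , f =
      1ℚ + ∣ s N ∣ℚ ,
      ℚₚ.+-mono-<-≤ (ℚₚ.positive⁻¹ 1ℚ) (ℚₚ.0≤∣p∣ (s N)) ,
      N , λ n N≤n → near⇒bounded (s n) (s N) (f n N N≤n ℕₚ.≤-refl)

    scaled : ∀ {B δ} → 0ℚ ℚ.< B → 0ℚ ℚ.< δ → Σ[ γ ∈ ℚ ] 0ℚ ℚ.< γ × B * γ ≡ δ
    scaled {B} {δ} 0<B 0<δ = 1/ B * δ , 0<γ , eq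
      where
      instance
        B-pos : Positive B
        B-pos = positive 0<B
        B-nz : NonZero B
        B-nz = ℚₚ.pos⇒nonZero B
        1/B-pos : Positive (1/ B)
        1/B-pos = ℚₚ.1/pos⇒pos B
      0<γ : 0ℚ ℚ.< 1/ B * δ
      0<γ = subst (ℚ._< 1/ B * δ) (ℚₚ.*-zeroʳ (1/ B))
              (ℚₚ.*-monoʳ-<-pos (1/ B) {0ℚ} {δ} 0<δ)
      eq : B * (1/ B * δ) ≡ δ
      eq = trans (sym (ℚₚ.*-assoc B (1/ B) δ))
             (trans (cong (_* δ) (ℚₚ.*-inverseʳ B)) (ℚₚ.*-identityˡ δ))

    *-bound : ∀ {B γ} p q → 0ℚ ℚ.< B → ∣ p ∣ℚ ℚ.≤ B → ∣ q ∣ℚ ℚ.< γ →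
              ∣ p * q ∣ℚ ℚ.< B * γ
    *-bound {B} {γ} p q 0<B p≤B q<γ = begin-strict
      ∣ p * q ∣ℚ         ≡⟨ ℚₚ.∣p*q∣≡∣p∣*∣q∣ p q ⟩
      ∣ p ∣ℚ * ∣ q ∣ℚ    ≤⟨ ℚₚ.*-monoʳ-≤-nonNeg ∣ q ∣ℚ {{nonNegative (ℚₚ.0≤∣p∣ q)}} p≤B ⟩
      B * ∣ q ∣ℚ         <⟨ ℚₚ.*-monoʳ-<-pos B {{positive 0<B}} q<γ ⟩
      B * γ ∎
      where
      open ℚₚ.≤-Reasoning

    *-close : ∀ {A B α β δ} a b c d → 0ℚ ℚ.< A → 0ℚ ℚ.< B →
              A * α ≡ half δ → B * β ≡ half δ →
              ∣ a ∣ℚ ℚ.≤ A → ∣ d ∣ℚ ℚ.≤ B → ∣ b - d ∣ℚ ℚ.< α → ∣ a - c ∣ℚ ℚ.< β →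
              ∣ a * b - c * d ∣ℚ ℚ.< δ
    *-close {A} {B} {α} {β} {δ} a b c d 0<A 0<B Aα Bβ a≤A d≤B b-d a-c = begin-strict
      ∣ a * b - c * d ∣ℚ
        ≡⟨ cong ∣_∣ℚ (rearrange a b c d) ⟩
      ∣ a * (b - d) + d * (a - c) ∣ℚ
        ≤⟨ ℚₚ.∣p+q∣≤∣p∣+∣q∣ (a * (b - d)) (d * (a - c)) ⟩
      ∣ a * (b - d) ∣ℚ + ∣ d * (a - c) ∣ℚ
        <⟨ ℚₚ.+-mono-< (*-bound a (b - d) 0<A a≤A b-d) (*-bound d (a - c) 0<B d≤B a-c) ⟩
      A * α + B * β
        ≡⟨ cong₂ _+_ Aα Bβ ⟩
      half δ + half δ
        ≡⟨ half+half δ ⟩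
      δ ∎
      where
      open ℚₚ.≤-Reasoning
      rearrange : ∀ w x y z → w * x - y * z ≡ w * (x - z) + z * (w - y)
      rearrange = solve 4 (λ w x y z → w :* x :- y :* z := w :* (x :- z) :+ z :* (w :- y)) refl
        where open +-*-Solver

    *-cauchy : ∀ s u → IsCauchy s → IsCauchy u → IsCauchy (λ n → s n * u n)
    *-cauchy s u cs cu δ 0<δ = step₁ (bounded s cs) (bounded u cu)
      where
      Bound : (ℕ → ℚ) → ℚ → Set
      Bound v B = ∃[ N ] ∀ n → N ℕ.≤ n → ∣ v n ∣ℚ ℚ.≤ B

      Modulus : (ℕ → ℚ) → ℚ → Set
      Modulus v γ = ∃[ N ] ∀ m n → N ℕ.≤ m → N ℕ.≤ n → ∣ v m - v n ∣ℚ ℚ.< γ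

      Goal : Set
      Goal = Modulus (λ n → s n * u n) δ

      step₃ : ∀ {A B α β} → 0ℚ ℚ.< A → 0ℚ ℚ.< B → A * α ≡ half δ → B * β ≡ half δ →
              Bound s A → Bound u B → Modulus u α → Modulus s β → Goal
      step₃ 0<A 0<B Aα Bβ (K , fK) (L , fL) (M , fM) (N , fN) =
        (K ⊔ L) ⊔ (M ⊔ N) , λ m n p q →
        let p₁ = ℕₚ.m⊔n≤o⇒m≤o (K ⊔ L) (M ⊔ N) p
            p₂ = ℕₚ.m⊔n≤o⇒n≤o (K ⊔ L) (M ⊔ N) p
            q₁ = ℕₚ.m⊔n≤o⇒m≤o (K ⊔ L) (M ⊔ N) q
            q₂ = ℕₚ.m⊔n≤o⇒n≤o (K ⊔ L) (M ⊔ N) q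
        in *-close (s m) (u m) (s n) (u n) 0<A 0<B Aα Bβ
             (fK m (ℕₚ.m⊔n≤o⇒m≤o K L p₁))
             (fL n (ℕₚ.m⊔n≤o⇒n≤o K L q₁))
             (fM m n (ℕₚ.m⊔n≤o⇒m≤o M N p₂) (ℕₚ.m⊔n≤o⇒m≤o M N q₂))
             (fN m n (ℕₚ.m⊔n≤o⇒n≤o M N p₂) (ℕₚ.m⊔n≤o⇒n≤o M N q₂))

      step₂ : ∀ {A B} → 0ℚ ℚ.< A → 0ℚ ℚ.< B → Bound s A → Bound u B →
              Σ[ α ∈ ℚ ] 0ℚ ℚ.< α × A * α ≡ half δ →
              Σ[ β ∈ ℚ ] 0ℚ ℚ.< β × B * β ≡ half δ → Goal
      step₂ 0<A 0<B bs bu (α , 0<α , Aα) (β , 0<β , Bβ) =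
        step₃ 0<A 0<B Aα Bβ bs bu (cu α 0<α) (cs β 0<β)

      step₁ : Σ[ A ∈ ℚ ] 0ℚ ℚ.< A × Bound s A → Σ[ B ∈ ℚ ] 0ℚ ℚ.< B × Bound u B → Goal
      step₁ (A , 0<A , bs) (B , 0<B , bu) =
        step₂ 0<A 0<B bs bu (scaled {A} {half δ} 0<A (half-pos {δ} 0<δ))
                            (scaled {B} {half δ} 0<B (half-pos {δ} 0<δ))

_+ᴿ_ : ℝ → ℝ → ℝ
x +ᴿ y = mkℝ (λ n → seq x n + seq y n)
             (+-cauchy (seq x) (seq y) (cauchy x) (cauchy y))

_*ᴿ_ : ℝ → ℝ → ℝ
x *ᴿ y = mkℝ (λ n → seq x n * seq y n)
             (*-cauchy (seq x) (seq y) (cauchy x) (cauchy y))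

------------------------------------------------------------------------
-- Finite simple graphs, paths and trees

record Graph : Set₁ where
  field
    order    : ℕ
    _~_      : Rel (Fin order) 0ℓ
    ~-sym    : Symmetric _~_
    ~-irrefl : Irreflexive _≡_ _~_
    _~?_     : Decidable _~_

  Vertex : Set
  Vertex = Fin order

  Walk : Rel Vertex 0ℓ
  Walk = Star _~_

  vertices : ∀ {x y} → Walk x y → List Vertex
  vertices {x} stop    = x ∷ []
  vertices {x} (_ ◅ p) = x ∷ vertices p

  Path : Rel Vertex 0ℓ
  Path x y = Σ[ p ∈ Walk x y ] Unique (vertices p)

  Connected : Set
  Connected = ∀ x y → Path x y

  -- A cycle is a path on at least three vertices whose ends are adjacent.
  Acyclic : Set
  Acyclic = ∀ x y (p : Path x y) → 3 ℕ.≤ length (vertices (proj₁ p)) → ¬ (y ~ x)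

  IsTree : Set
  IsTree = 1 ℕ.≤ order × Connected × Acyclic

open Graph public using (Vertex)

------------------------------------------------------------------------
-- Treewidth

record TreeDecomposition (G : Graph) : Set₁ where
  open Graph G using (_~_)
  field
    tree   : Graph
    isTree : Graph.IsTree tree
    bag    : Vertex tree → Subset (Graph.order G)

    vertex-covered : ∀ v → ∃[ i ] v ∈ bag i
    edge-covered   : ∀ {u v} → u ~ v → ∃[ i ] u ∈ bag i × v ∈ bag i
    bags-connected : ∀ v i j → v ∈ bag i → v ∈ bag j →
      Σ[ p ∈ Graph.Path tree i j ] All (λ k → v ∈ bag k) (Graph.vertices tree (proj₁ p))

  width : ℕ
  width = max 0 (tabulate (λ i → ∣ bag i ∣)) ∸ 1

open TreeDecomposition public using (width)

IsTreewidth : Graph → ℕ → Set₁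
IsTreewidth G k = (Σ[ D ∈ TreeDecomposition G ] width D ≡ k)
                × (∀ (D : TreeDecomposition G) → k ℕ.≤ width D)

-- A minimum is at most m iff some member is; see treewidth≤⇔.
TreewidthAtMost : Graph → ℕ → Set₁
TreewidthAtMost G m = Σ[ D ∈ TreeDecomposition G ] width D ℕ.≤ m

treewidth≤⇔ : ∀ {G k m} → IsTreewidth G k → k ℕ.≤ m ⇔ TreewidthAtMost G m
treewidth≤⇔ ((D , eq) , least) = mk⇔
  (λ k≤m → D , subst (ℕ._≤ _) (sym eq) k≤m)
  (λ (D′ , w≤m) → ℕₚ.≤-trans (least D′) w≤m)

------------------------------------------------------------------------
-- Edge-weighted graphs and the metrics they induce

record WeightedGraph : Set₁ where
  field
    graph : Graph

  open Graph graph using (_~_; Walk; Path)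

  field
    weight        : ∀ {u v} → u ~ v → ℝ
    weight-nonNeg : ∀ {u v} (e : u ~ v) → 0ᴿ ≤ᴿ weight e
    -- Applied twice, this also makes the weight independent of the
    -- adjacency proof, so each undirected edge has one weight.
    weight-sym    : ∀ {u v} (e : u ~ v) (f : v ~ u) → weight e ≈ᴿ weight f

  walkWeight : ∀ {x y} → Walk x y → ℝ
  walkWeight stop    = 0ᴿ
  walkWeight (e ◅ p) = weight e +ᴿ walkWeight p

  pathWeight : ∀ {x y} → Path x y → ℝ
  pathWeight (p , _) = walkWeight p

  IsDistance : Vertex graph → Vertex graph → ℝ → Set
  IsDistance x y d = (Σ[ p ∈ Path x y ] pathWeight p ≈ᴿ d)
                   × (∀ (p : Path x y) → d ≤ᴿ pathWeight p)

open WeightedGraph public using (graph)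

record Metric (V : Set) : Set where
  field
    dist     : V → V → ℝ
    isMetric : IsGeneralMetric _≡_ _≈ᴿ_ _≤ᴿ_ 0ᴿ _+ᴿ_ dist

Induces : (G : WeightedGraph) → Metric (Vertex (graph G)) → Set
Induces G M = ∀ x y → WeightedGraph.IsDistance G x y (Metric.dist M x y)

------------------------------------------------------------------------
-- Ladders and scatter dimension

record Ladder {V : Set} (M : Metric V) (ε : ℝ) (ℓ : ℕ) : Set where
  open Metric M using (dist)
  field
    x p       : Fin ℓ → V
    ϱ         : ℝ
    ϱ-pos     : 0ᴿ <ᴿ ϱ
    close     : ∀ {i j} → j <ᶠ i → dist (p j) (x i) ≤ᴿ ϱ
    separated : ∀ i → (1ᴿ +ᴿ ε) *ᴿ ϱ <ᴿ dist (p i) (x i)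

IsScatterDimension : {V : Set} → Metric V → ℝ → ℕ → Set
IsScatterDimension M ε d = Ladder M ε d × (∀ ℓ → Ladder M ε ℓ → ℓ ℕ.≤ d)

-- A maximum is at least m iff some member is; see scatterDimension≥⇔. The
-- maximum itself is not computable for arbitrary real ε.
ScatterDimensionAtLeast : {V : Set} → Metric V → ℝ → ℕ → Set
ScatterDimensionAtLeast M ε m = ∃[ ℓ ] Ladder M ε ℓ × m ℕ.≤ ℓ

scatterDimension≥⇔ : ∀ {V} {M : Metric V} {ε d m} → IsScatterDimension M ε d →
                     m ℕ.≤ d ⇔ ScatterDimensionAtLeast M ε m
scatterDimension≥⇔ (L , longest) = mk⇔
  (λ m≤d → _ , L , m≤d)
  (λ (ℓ , L′ , m≤ℓ) → ℕₚ.≤-trans m≤ℓ (longest ℓ L′))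

{-# OPTIONS --safe #-}
module Submission where

-- A graph with terminals P i and X i (i < ℓ) realises a ladder of width ρ and
-- gap 2 if d(P j, X i) ≤ ρ for j < i and d(P i, X i) ≥ ρ + 2.  Given such a
-- graph O of width ρ with m rungs and I of width ρ + 2 with n rungs, take a copy
-- of I for each rung i of O and join all its P-terminals to P i and all its
-- X-terminals to X i by edges of weight 1.  The terminals of the copies, ordered
-- lexicographically, form a ladder of width ρ + 2, gap 2 and m * n rungs: between
-- different copies the path through O costs 1 + ρ + 1, within a copy the ladder
-- of I is used, and any detour through the hubs P i, X i costs at least ρ + 4,
-- because every P–X distance is at least the width.
-- Treewidth is max (tw O) (tw I + 2), since only the two hubs are added to the
-- bags of I.  With ρ = 2 (r + 2) the relative gap is 1 / (r + 2), so taking O from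
-- (t + 1, r) and I from (t, r + 1) multiplies the lengths along Pascal's rule.
-- All weights are natural numbers, and distances are bounded below by
-- 1-Lipschitz potentials, which glue along the hubs.

open import Defs
open import Data.Empty using (⊥)
open import Data.Fin.Base as Fin using (Fin; combine; remQuot)
open import Data.Fin.Patterns using (0F; 1F; 2F; 3F)
import Data.Fin.Properties as Finₚ
open import Data.Fin.Subset as Subset using (Subset; ⁅_⁆; _∪_; ∣_∣)
import Data.Fin.Subset.Properties as Subsetₚ
open import Data.Integer.Base as ℤ using (+_)
import Data.Integer.Properties as ℤₚ
open import Data.List.Base as List using (List; []; _∷_; length)
open import Data.List.Extrema.Nat using (max≤v⁺)
open import Data.List.Membership.Propositional using (_∈_)
open import Data.List.Membership.Propositional.Properties using (∈-map⁺; ∈-map⁻)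
open import Data.List.Properties using (length-map)
open import Data.List.Relation.Binary.Subset.Propositional using (_⊆_)
import Data.List.Relation.Binary.Subset.Propositional.Properties as ⊆ₚ
open import Data.List.Relation.Unary.All as All using (All; []; _∷_)
open import Data.List.Relation.Unary.All.Properties using (¬Any⇒All¬; anti-mono; tabulate⁺)
open import Data.List.Relation.Unary.AllPairs using ([]; _∷_)
open import Data.List.Relation.Unary.Any using (here; there; any?)
open import Data.List.Relation.Unary.Unique.Propositional using (Unique)
open import Data.Maybe.Base as Maybe using (Maybe; just; nothing)
import Data.Maybe.Properties as Maybeₚ
open import Data.Nat.Base as ℕ
  using (ℕ; zero; suc; _+_; _*_; _^_; _∸_; _⊔_; _≤_; _<_; z≤n; s≤s)
open import Data.Nat.Combinatorics using (_C_; nCk≡nC[n∸k]; nCn≡1; nCk+nC[k+1]≡[n+1]C[k+1])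
open import Data.Nat.Induction using (<-wellFounded)
import Data.Nat.Properties as ℕₚ
open import Data.Product.Base using (Σ-syntax; ∃-syntax; _×_; _,_; proj₁; proj₂)
open import Data.Product.Function.NonDependent.Propositional using (_×-↔_)
open import Data.Rational.Base as ℚ using (ℚ; 0ℚ; 1ℚ; ½; _/_; toℚᵘ) renaming (∣_∣ to ∣_∣ℚ)
import Data.Rational.Properties as ℚₚ
open import Data.Rational.Solver using (module +-*-Solver)
open import Data.Rational.Unnormalised.Base as ℚᵘ using (mkℚᵘ; *≡*)
import Data.Rational.Unnormalised.Properties as ℚᵘₚ
open import Data.Sum.Base as Sum using (_⊎_; inj₁; inj₂)
open import Data.Sum.Function.Propositional using (_⊎-↔_)
open import Data.Unit.Base using (⊤; tt)
open import Data.Vec.Base using ([]; _∷_)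
open import Data.Bool.Base using (true; false)
open import Function.Base using (_∘_)
open import Function.Bundles using (_↔_; mk↔ₛ′; module Inverse)
open import Function.Construct.Composition using (_↔-∘_)
open import Function.Construct.Identity using (↔-id)
open import Function.Construct.Symmetry using (↔-sym)
open import Function.Properties.Inverse using (↔⇒↣)
open import Induction.WellFounded using (Acc; acc)
open import Level using (0ℓ)
open import Relation.Binary.Core using (Rel)
open import Relation.Binary.Construct.Closure.ReflexiveTransitive
  using (Star; _◅_; _◅◅_) renaming (ε to stop)
open import Relation.Binary.Definitions using (DecidableEquality; tri<; tri≈; tri>)
open import Relation.Binary.PropositionalEquality
  using (_≡_; refl; sym; trans; cong; cong₂; subst; subst₂; isEquivalence; module ≡-Reasoning)
open import Relation.Binary.Structures using (IsPartialOrder)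
open import Relation.Nullary.Decidable using (Dec; yes; no; map′; _⊎-dec_)
open import Relation.Nullary.Negation using (¬_; contradiction)

-- Order on reals

p≤∣p∣ : ∀ p → p ℚ.≤ ∣ p ∣ℚ
p≤∣p∣ p with ℚₚ.≤-total 0ℚ p
... | inj₁ 0≤p = ℚₚ.≤-reflexive (sym (ℚₚ.0≤p⇒∣p∣≡p 0≤p))
... | inj₂ p≤0 = ℚₚ.≤-trans p≤0 (ℚₚ.0≤∣p∣ p)

-[p-q]≡q-p : ∀ p q → ℚ.- (p ℚ.- q) ≡ q ℚ.- p
-[p-q]≡q-p = solve 2 (λ p q → :- (p :- q) := q :- p) refl
  where open +-*-Solver

∣p-q∣≡∣q-p∣ : ∀ p q → ∣ p ℚ.- q ∣ℚ ≡ ∣ q ℚ.- p ∣ℚ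
∣p-q∣≡∣q-p∣ p q = trans (sym (ℚₚ.∣-p∣≡∣p∣ (p ℚ.- q))) (cong ∣_∣ℚ (-[p-q]≡q-p p q))

∣p-q∣<r⇒p≤q+r : ∀ p q {r} → ∣ p ℚ.- q ∣ℚ ℚ.< r → p ℚ.≤ q ℚ.+ r
∣p-q∣<r⇒p≤q+r p q {r} close = begin
  p                          ≡⟨ add-sub p q ⟩
  q ℚ.+ (p ℚ.- q)            ≤⟨ ℚₚ.+-monoʳ-≤ q (p≤∣p∣ (p ℚ.- q)) ⟩
  q ℚ.+ ∣ p ℚ.- q ∣ℚ         ≤⟨ ℚₚ.+-monoʳ-≤ q (ℚₚ.<⇒≤ close) ⟩
  q ℚ.+ r                    ∎
  where
  open ℚₚ.≤-Reasoning
  open +-*-Solver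
  add-sub : ∀ a b → a ≡ b ℚ.+ (a ℚ.- b)
  add-sub = solve 2 (λ a b → a := b :+ (a :- b)) refl

p≤q+r⇒p-q≤r : ∀ p q {r} → p ℚ.≤ q ℚ.+ r → p ℚ.- q ℚ.≤ r
p≤q+r⇒p-q≤r p q {r} p≤q+r = begin
  p ℚ.- q            ≤⟨ ℚₚ.+-monoˡ-≤ (ℚ.- q) p≤q+r ⟩
  q ℚ.+ r ℚ.- q      ≡⟨ cancel q r ⟩
  r                  ∎
  where
  open ℚₚ.≤-Reasoning
  open +-*-Solver
  cancel : ∀ a b → a ℚ.+ b ℚ.- a ≡ b
  cancel = solve 2 (λ a b → a :+ b :- a := b) refl

p≤q+r∧q≤p+r⇒∣p-q∣≤r : ∀ p q {r} → p ℚ.≤ q ℚ.+ r → q ℚ.≤ p ℚ.+ r → ∣ p ℚ.- q ∣ℚ ℚ.≤ r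
p≤q+r∧q≤p+r⇒∣p-q∣≤r p q {r} p≤ q≤ with ℚₚ.∣p∣≡p∨∣p∣≡-p (p ℚ.- q)
... | inj₁ eq = subst (ℚ._≤ r) (sym eq) (p≤q+r⇒p-q≤r p q p≤)
... | inj₂ eq = subst (ℚ._≤ r) (sym (trans eq (-[p-q]≡q-p p q))) (p≤q+r⇒p-q≤r q p q≤)

½-pos : ∀ {δ} → 0ℚ ℚ.< δ → 0ℚ ℚ.< ½ ℚ.* δ
½-pos {δ} 0<δ = subst (ℚ._< ½ ℚ.* δ) (ℚₚ.*-zeroʳ ½) (ℚₚ.*-monoʳ-<-pos ½ {0ℚ} {δ} 0<δ)

½+½ : ∀ δ → ½ ℚ.* δ ℚ.+ ½ ℚ.* δ ≡ δ
½+½ δ = trans (sym (ℚₚ.*-distribʳ-+ δ ½ ½)) (ℚₚ.*-identityˡ δ)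

½*δ<δ : ∀ {δ} → 0ℚ ℚ.< δ → ½ ℚ.* δ ℚ.< δ
½*δ<δ {δ} 0<δ = subst₂ ℚ._<_ (ℚₚ.+-identityˡ _) (½+½ δ) (ℚₚ.+-monoˡ-< (½ ℚ.* δ) (½-pos 0<δ))

≤ᴿ-trans : ∀ {x y z} → x ≤ᴿ y → y ≤ᴿ z → x ≤ᴿ z
≤ᴿ-trans {x} {y} {z} x≤y y≤z δ 0<δ with x≤y (½ ℚ.* δ) (½-pos 0<δ) | y≤z (½ ℚ.* δ) (½-pos 0<δ)
... | M , fM | N , fN = M ⊔ N , λ n M⊔N≤n → begin
  seq x n                                  ≤⟨ fM n (ℕₚ.m⊔n≤o⇒m≤o M N M⊔N≤n) ⟩
  seq y n ℚ.+ ½ ℚ.* δ                      ≤⟨ ℚₚ.+-monoˡ-≤ (½ ℚ.* δ) (fN n (ℕₚ.m⊔n≤o⇒n≤o M N M⊔N≤n)) ⟩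
  seq z n ℚ.+ ½ ℚ.* δ ℚ.+ ½ ℚ.* δ          ≡⟨ ℚₚ.+-assoc (seq z n) _ _ ⟩
  seq z n ℚ.+ (½ ℚ.* δ ℚ.+ ½ ℚ.* δ)        ≡⟨ cong (seq z n ℚ.+_) (½+½ δ) ⟩
  seq z n ℚ.+ δ                            ∎
  where open ℚₚ.≤-Reasoning

≈ᴿ-sym : ∀ {x y} → x ≈ᴿ y → y ≈ᴿ x
≈ᴿ-sym {x} {y} x≈y δ 0<δ with x≈y δ 0<δ
... | N , f = N , λ n N≤n → subst (ℚ._< δ) (∣p-q∣≡∣q-p∣ (seq x n) (seq y n)) (f n N≤n)

≈ᴿ⇒≤ᴿ : ∀ {x y} → x ≈ᴿ y → x ≤ᴿ y
≈ᴿ⇒≤ᴿ {x} {y} x≈y δ 0<δ with x≈y δ 0<δ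
... | N , f = N , λ n N≤n → ∣p-q∣<r⇒p≤q+r (seq x n) (seq y n) (f n N≤n)

≤ᴿ-antisym : ∀ {x y} → x ≤ᴿ y → y ≤ᴿ x → x ≈ᴿ y
≤ᴿ-antisym {x} {y} x≤y y≤x δ 0<δ with x≤y (½ ℚ.* δ) (½-pos 0<δ) | y≤x (½ ℚ.* δ) (½-pos 0<δ)
... | M , fM | N , fN = M ⊔ N , λ n M⊔N≤n →
  -- The two hypotheses only give `≤`; taking them at half of `δ` leaves room for the strict bound
  -- that `_≈ᴿ_` asks for.
  ℚₚ.≤-<-trans
    (p≤q+r∧q≤p+r⇒∣p-q∣≤r (seq x n) (seq y n)
      (fM n (ℕₚ.m⊔n≤o⇒m≤o M N M⊔N≤n)) (fN n (ℕₚ.m⊔n≤o⇒n≤o M N M⊔N≤n)))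
    (½*δ<δ 0<δ)

≡⇒≈ᴿ : ∀ {x y} → (∀ n → seq x n ≡ seq y n) → x ≈ᴿ y
≡⇒≈ᴿ {x} {y} x≡y δ 0<δ = 0 , λ n _ →
  subst (ℚ._< δ) (sym (trans (cong (λ q → ∣ q ℚ.- seq y n ∣ℚ) (x≡y n)) (cong ∣_∣ℚ (ℚₚ.+-inverseʳ (seq y n))))) 0<δ

≤ᴿ-isPartialOrder : IsPartialOrder _≈ᴿ_ _≤ᴿ_
≤ᴿ-isPartialOrder = record
  { isPreorder = record
    { isEquivalence = record
      { refl  = λ {x} → ≡⇒≈ᴿ {x} {x} λ _ → refl
      ; sym   = λ {x} {y} → ≈ᴿ-sym {x} {y}
      ; trans = λ {x} {y} {z} x≈y y≈z → ≤ᴿ-antisym {x} {z}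
          (≤ᴿ-trans {x} {y} {z} (≈ᴿ⇒≤ᴿ {x} {y} x≈y) (≈ᴿ⇒≤ᴿ {y} {z} y≈z))
          (≤ᴿ-trans {z} {y} {x} (≈ᴿ⇒≤ᴿ {z} {y} (≈ᴿ-sym {y} {z} y≈z)) (≈ᴿ⇒≤ᴿ {y} {x} (≈ᴿ-sym {x} {y} x≈y)))
      }
    ; reflexive = λ {x} {y} → ≈ᴿ⇒≤ᴿ {x} {y}
    ; trans     = λ {x} {y} {z} → ≤ᴿ-trans {x} {y} {z}
    }
  ; antisym = λ {x} {y} → ≤ᴿ-antisym {x} {y}
  }

-- Natural numbers as rationals and reals

-- Recursive, so that sums, products and order transfer by induction without normalising fractions.
-- The bridge to `_/_` serves only the threshold `1 / (r + 2)`.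
fromℕ : ℕ → ℚ
fromℕ zero    = 0ℚ
fromℕ (suc n) = 1ℚ ℚ.+ fromℕ n

fromℕ-+ : ∀ m n → fromℕ (m ℕ.+ n) ≡ fromℕ m ℚ.+ fromℕ n
fromℕ-+ zero    n = sym (ℚₚ.+-identityˡ (fromℕ n))
fromℕ-+ (suc m) n = trans (cong (1ℚ ℚ.+_) (fromℕ-+ m n)) (sym (ℚₚ.+-assoc 1ℚ (fromℕ m) (fromℕ n)))

fromℕ-* : ∀ m n → fromℕ (m ℕ.* n) ≡ fromℕ m ℚ.* fromℕ n
fromℕ-* zero    n = sym (ℚₚ.*-zeroˡ (fromℕ n))
fromℕ-* (suc m) n = begin
  fromℕ (n ℕ.+ m ℕ.* n)                          ≡⟨ fromℕ-+ n (m ℕ.* n) ⟩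
  fromℕ n ℚ.+ fromℕ (m ℕ.* n)                    ≡⟨ cong (fromℕ n ℚ.+_) (fromℕ-* m n) ⟩
  fromℕ n ℚ.+ fromℕ m ℚ.* fromℕ n                ≡⟨ cong (ℚ._+ fromℕ m ℚ.* fromℕ n) (sym (ℚₚ.*-identityˡ (fromℕ n))) ⟩
  1ℚ ℚ.* fromℕ n ℚ.+ fromℕ m ℚ.* fromℕ n         ≡⟨ sym (ℚₚ.*-distribʳ-+ (fromℕ n) 1ℚ (fromℕ m)) ⟩
  (1ℚ ℚ.+ fromℕ m) ℚ.* fromℕ n                   ∎
  where open ≡-Reasoning

0≤fromℕ : ∀ n → 0ℚ ℚ.≤ fromℕ n
0≤fromℕ zero    = ℚₚ.≤-refl
0≤fromℕ (suc n) = ℚₚ.+-mono-≤ (ℚₚ.nonNegative⁻¹ 1ℚ) (0≤fromℕ n)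

fromℕ-mono-≤ : ∀ {m n} → m ℕ.≤ n → fromℕ m ℚ.≤ fromℕ n
fromℕ-mono-≤ {n = n} z≤n = 0≤fromℕ n
fromℕ-mono-≤ (s≤s m≤n)   = ℚₚ.+-monoʳ-≤ 1ℚ (fromℕ-mono-≤ m≤n)

fromℕ-/ : ∀ n → fromℕ n ≡ + n / 1
fromℕ-/ zero    = refl
fromℕ-/ (suc n) = trans (cong (1ℚ ℚ.+_) (fromℕ-/ n)) (ℚₚ.toℚᵘ-injective (begin
  toℚᵘ (1ℚ ℚ.+ + n / 1)           ≈⟨ ℚₚ.toℚᵘ-homo-+ 1ℚ (+ n / 1) ⟩
  toℚᵘ 1ℚ ℚᵘ.+ toℚᵘ (+ n / 1)     ≈⟨ ℚᵘₚ.+-congʳ (toℚᵘ 1ℚ) (ℚₚ.toℚᵘ-fromℚᵘ (mkℚᵘ (+ n) 0)) ⟩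
  toℚᵘ 1ℚ ℚᵘ.+ mkℚᵘ (+ n) 0       ≈⟨ *≡* (cong (ℤ._* + 1) (cong (ℤ._+_ (+ 1)) (ℤₚ.*-identityʳ (+ n)))) ⟩
  mkℚᵘ (+ suc n) 0                ≈⟨ ℚₚ.toℚᵘ-fromℚᵘ (mkℚᵘ (+ suc n) 0) ⟨
  toℚᵘ (+ suc n / 1)              ∎))
  where
  open ℚᵘₚ.≃-Reasoning

1/n*n≡1 : ∀ n → (+ 1 / suc n) ℚ.* fromℕ (suc n) ≡ 1ℚ
1/n*n≡1 n = trans (cong ((+ 1 / suc n) ℚ.*_) (fromℕ-/ (suc n))) (ℚₚ.toℚᵘ-injective (begin
  toℚᵘ ((+ 1 / suc n) ℚ.* (+ suc n / 1))             ≈⟨ ℚₚ.toℚᵘ-homo-* (+ 1 / suc n) (+ suc n / 1) ⟩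
  toℚᵘ (+ 1 / suc n) ℚᵘ.* toℚᵘ (+ suc n / 1)
    ≈⟨ ℚᵘₚ.*-cong (ℚₚ.toℚᵘ-fromℚᵘ (mkℚᵘ (+ 1) n)) (ℚₚ.toℚᵘ-fromℚᵘ (mkℚᵘ (+ suc n) 0)) ⟩
  mkℚᵘ (+ 1) n ℚᵘ.* mkℚᵘ (+ suc n) 0                 ≈⟨ ℚᵘₚ.*-inverseˡ (mkℚᵘ (+ suc n) 0) ⟩
  toℚᵘ 1ℚ                                            ∎))
  where
  open ℚᵘₚ.≃-Reasoning

-- The single tolerance `1ℚ` decides it, since a nonzero natural number is at distance at least one
-- from zero.
fromℕ≈0⇒≡0 : ∀ n → fromℚ (fromℕ n) ≈ᴿ 0ᴿ → n ≡ 0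
fromℕ≈0⇒≡0 zero    _   = refl
fromℕ≈0⇒≡0 (suc n) n≈0 with n≈0 1ℚ (ℚₚ.positive⁻¹ 1ℚ)
... | N , f = contradiction (ℚₚ.≤-<-trans 1≤ (f N ℕₚ.≤-refl)) (ℚₚ.<-irrefl refl)
  where
  1≤ : 1ℚ ℚ.≤ ∣ fromℕ (suc n) ℚ.- 0ℚ ∣ℚ
  1≤ = begin
    1ℚ                           ≤⟨ ℚₚ.+-monoʳ-≤ 1ℚ (0≤fromℕ n) ⟩
    fromℕ (suc n)                ≡⟨ ℚₚ.+-identityʳ (fromℕ (suc n)) ⟨
    fromℕ (suc n) ℚ.- 0ℚ         ≤⟨ p≤∣p∣ _ ⟩
    ∣ fromℕ (suc n) ℚ.- 0ℚ ∣ℚ    ∎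
    where open ℚₚ.≤-Reasoning

fromℚ-mono-≤ : ∀ {p q} → p ℚ.≤ q → fromℚ p ≤ᴿ fromℚ q
fromℚ-mono-≤ {p} {q} p≤q δ 0<δ = 0 , λ _ _ →
  subst (ℚ._≤ q ℚ.+ δ) (ℚₚ.+-identityʳ p) (ℚₚ.+-mono-≤ p≤q (ℚₚ.<⇒≤ 0<δ))

0<fromℕ-suc : ∀ n → 0ℚ ℚ.< fromℕ (suc n)
0<fromℕ-suc n = ℚₚ.+-mono-<-≤ (ℚₚ.positive⁻¹ 1ℚ) (0≤fromℕ n)

-- A gap `c` over the width `suc n * c` is a relative gap of exactly `1 / suc n`. The slack `δ`
-- between `ε` and this threshold, multiplied by the width, is the uniform gap that `_<ᴿ_` demands.
scaled-separation : ∀ n c {d} ε → ε <ᴿ fromℚ (+ 1 / suc n) → 0 ℕ.< c → suc (suc n) ℕ.* c ℕ.≤ d →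
  (1ᴿ +ᴿ ε) *ᴿ fromℚ (fromℕ (suc n ℕ.* c)) <ᴿ fromℚ (fromℕ d)
scaled-separation n c@(suc c-1) {d} ε (δ , 0<δ , N , f) 0<c le = δ ℚ.* ρ , 0<δρ , N , λ k N≤k → begin
  (1ℚ ℚ.+ seq ε k) ℚ.* ρ ℚ.+ δ ℚ.* ρ                 ≡⟨ rearrange (seq ε k) ρ δ ⟩
  ρ ℚ.+ (seq ε k ℚ.+ δ) ℚ.* ρ                        ≤⟨ ℚₚ.+-monoʳ-≤ ρ (ℚₚ.*-monoʳ-≤-nonNeg ρ (f k N≤k)) ⟩
  ρ ℚ.+ (+ 1 / suc n) ℚ.* ρ                          ≡⟨ cong (λ q → ρ ℚ.+ (+ 1 / suc n) ℚ.* q) (fromℕ-* (suc n) c) ⟩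
  ρ ℚ.+ (+ 1 / suc n) ℚ.* (fromℕ (suc n) ℚ.* fromℕ c)
    ≡⟨ cong (ρ ℚ.+_) (sym (ℚₚ.*-assoc (+ 1 / suc n) (fromℕ (suc n)) (fromℕ c))) ⟩
  ρ ℚ.+ (+ 1 / suc n) ℚ.* fromℕ (suc n) ℚ.* fromℕ c
    ≡⟨ cong (λ q → ρ ℚ.+ q ℚ.* fromℕ c) (1/n*n≡1 n) ⟩
  ρ ℚ.+ 1ℚ ℚ.* fromℕ c                               ≡⟨ cong (ρ ℚ.+_) (ℚₚ.*-identityˡ (fromℕ c)) ⟩
  ρ ℚ.+ fromℕ c                                      ≡⟨ fromℕ-+ (suc n ℕ.* c) c ⟨
  fromℕ (suc n ℕ.* c ℕ.+ c)                          ≡⟨ cong fromℕ (ℕₚ.+-comm (suc n ℕ.* c) c) ⟩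
  fromℕ (suc (suc n) ℕ.* c)                          ≤⟨ fromℕ-mono-≤ le ⟩
  fromℕ d                                            ∎
  where
  open ℚₚ.≤-Reasoning
  ρ : ℚ
  ρ = fromℕ (suc n ℕ.* c)
  0<ρ : 0ℚ ℚ.< ρ
  0<ρ = 0<fromℕ-suc (c-1 ℕ.+ n ℕ.* c)
  instance
    ρ-pos : ℚ.Positive ρ
    ρ-pos = ℚ.positive 0<ρ
    ρ-nonNeg : ℚ.NonNegative ρ
    ρ-nonNeg = ℚ.nonNegative (ℚₚ.<⇒≤ 0<ρ)
  0<δρ : 0ℚ ℚ.< δ ℚ.* ρ
  0<δρ = subst (ℚ._< δ ℚ.* ρ) (ℚₚ.*-zeroˡ ρ) (ℚₚ.*-monoˡ-<-pos ρ 0<δ)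
  rearrange : ∀ e r g → (1ℚ ℚ.+ e) ℚ.* r ℚ.+ g ℚ.* r ≡ r ℚ.+ (e ℚ.+ g) ℚ.* r
  rearrange = solve 3 (λ e r g → (con 1ℚ :+ e) :* r :+ g :* r := r :+ (e :+ g) :* r) refl
    where open +-*-Solver

-- Walks and the metrics induced by natural weights

total : ∀ {A : Set} {R : Rel A 0ℓ} → (∀ {u v} → R u v → ℕ) → ∀ {x y} → Star R x y → ℕ
total c stop    = 0
total c (e ◅ p) = c e + total c p

total-◅◅ : ∀ {A : Set} {R : Rel A 0ℓ} (c : ∀ {u v} → R u v → ℕ) {x y z}
           (p : Star R x y) (q : Star R y z) → total c (p ◅◅ q) ≡ total c p + total c q
total-◅◅ c stop    q = refl
total-◅◅ c (e ◅ p) q = trans (cong (_+_ (c e)) (total-◅◅ c p q)) (sym (ℕₚ.+-assoc (c e) _ _))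

module _ (G : Graph) where
  open Graph G

  -- The two clauses serve two purposes. The bound on costs turns shortest walks into shortest
  -- paths; the inclusion of vertices keeps a path of the decomposition tree among the bags that
  -- contain a given vertex.
  Shortcut : ∀ {x y z} → Walk z y → Path x y → Set
  Shortcut p q = vertices (proj₁ q) ⊆ vertices p
               × (∀ (c : ∀ {u v} → u ~ v → ℕ) → total c (proj₁ q) ≤ total c p)

  start∈ : ∀ {x y} (p : Walk x y) → x ∈ vertices p
  start∈ stop    = here refl
  start∈ (e ◅ p) = here refl

  suffix : ∀ {x y z} (q : Path z y) → x ∈ vertices (proj₁ q) → Σ[ s ∈ Path x y ] Shortcut (proj₁ q) s
  suffix (stop  , u)     (here refl) = (stop , u) , (λ m → m) , λ _ → ℕₚ.≤-refl
  suffix (e ◅ p , u)     (here refl) = (e ◅ p , u) , (λ m → m) , λ _ → ℕₚ.≤-refl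
  suffix (e ◅ p , _ ∷ u) (there m)   with suffix (p , u) m
  ... | s , sub , short = s , there ∘ sub , λ c → ℕₚ.≤-trans (short c) (ℕₚ.m≤n+m _ (c e))

  -- Erase the tail first. If the start occurs again in the erased tail, continue from that
  -- occurrence and drop everything before it; otherwise put the first edge back.
  loop-erasure : ∀ {x y} (p : Walk x y) → Σ[ q ∈ Path x y ] Shortcut p q
  loop-erasure stop = (stop , [] ∷ []) , (λ m → m) , λ _ → z≤n
  loop-erasure {x} (e ◅ p) with loop-erasure p
  ... | (q , u) , sub , short with any? (x Finₚ.≟_) (vertices q)
  ... | yes x∈q = let s , sub′ , short′ = suffix (q , u) x∈q in
    s , there ∘ sub ∘ sub′ , λ c → ℕₚ.≤-trans (short′ c) (ℕₚ.≤-trans (short c) (ℕₚ.m≤n+m _ (c e)))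
  ... | no  x∉q = (e ◅ q , ¬Any⇒All¬ (vertices q) x∉q ∷ u) , ⊆ₚ.∷⁺ʳ x sub , λ c → ℕₚ.+-monoʳ-≤ (c e) (short c)

-- w u v ≡ 0 encodes that u and v are not adjacent.
record Weighting (V : Set) : Set where
  field
    w        : V → V → ℕ
    w-sym    : ∀ u v → w u v ≡ w v u
    w-irrefl : ∀ u → w u u ≡ 0

  Edge : Rel V 0ℓ
  Edge u v = 0 < w u v

  Edge-sym : ∀ {u v} → Edge u v → Edge v u
  Edge-sym {u} {v} = subst (0 <_) (w-sym u v)

  len : ∀ {x y} → Star Edge x y → ℕ
  len = total λ {u} {v} _ → w u v

  len-◅◅ : ∀ {x y z} (p : Star Edge x y) (q : Star Edge y z) → len (p ◅◅ q) ≡ len p + len q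
  len-◅◅ = total-◅◅ λ {u} {v} _ → w u v

  rev : ∀ {x y} → Star Edge x y → Star Edge y x
  rev stop = stop
  rev (e ◅ p) = rev p ◅◅ (Edge-sym e ◅ stop)

  len-rev : ∀ {x y} (p : Star Edge x y) → len (rev p) ≡ len p
  len-rev stop = refl
  len-rev {x} (_◅_ {j = z} e p) = trans (len-◅◅ (rev p) (Edge-sym e ◅ stop))
    (trans (cong₂ _+_ (len-rev p) (trans (ℕₚ.+-identityʳ _) (w-sym z x))) (ℕₚ.+-comm (len p) _))

  Lipschitz : (V → ℕ) → Set
  Lipschitz f = ∀ u v → Edge u v → f u ≤ w u v + f v

  -- The source of the lower bounds on distances: a potential certifies them for all walks at once,
  -- without any analysis of which route a walk takes.
  Lipschitz⇒len : ∀ {f} → Lipschitz f → ∀ {x y} (p : Star Edge x y) → f x ≤ len p + f y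
  Lipschitz⇒len lip stop = ℕₚ.≤-refl
  Lipschitz⇒len {f} lip {x} {y} (_◅_ {j = z} e p) = begin
    f x                      ≤⟨ lip x z e ⟩
    w x z + f z              ≤⟨ ℕₚ.+-monoʳ-≤ (w x z) (Lipschitz⇒len lip p) ⟩
    w x z + (len p + f y)    ≡⟨ ℕₚ.+-assoc (w x z) _ _ ⟨
    w x z + len p + f y      ∎
    where open ℕₚ.≤-Reasoning

least : ∀ {P : ℕ → Set} → (∀ k → Dec (P k)) → ∀ n → P n → ∃[ m ] P m × (∀ k → P k → m ≤ k)
least P? zero    Pn = 0 , Pn , λ _ _ → z≤n
least {P} P? (suc n) Pn with P? 0
... | yes P0 = 0 , P0 , λ _ _ → z≤n
... | no ¬P0 with least {P ∘ suc} (P? ∘ suc) n Pn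
... | m , Pm , min = suc m , Pm , λ where
  zero    P0 → contradiction P0 ¬P0
  (suc k) Pk → s≤s (min k Pk)

module _ {n : ℕ} (W : Weighting (Fin n)) where
  open Weighting W

  weightGraph : Graph
  weightGraph = record
    { order    = n
    ; _~_      = Edge
    ; ~-sym    = Edge-sym
    ; ~-irrefl = λ { {u} refl e → ℕₚ.<-irrefl (sym (w-irrefl u)) e }
    ; _~?_     = λ u v → 0 ℕₚ.<? w u v
    }

  weightedGraph : WeightedGraph
  weightedGraph = record
    { graph         = weightGraph
    ; weight        = λ {u} {v} _ → fromℚ (fromℕ (w u v))
    ; weight-nonNeg = λ {u} {v} _ → fromℚ-mono-≤ (0≤fromℕ (w u v))
    ; weight-sym    = λ {u} {v} _ _ → ≡⇒≈ᴿ {fromℚ (fromℕ (w u v))} {fromℚ (fromℕ (w v u))}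
                        λ _ → cong fromℕ (w-sym u v)
    }

  seq-walkWeight : ∀ {x y} (p : Star Edge x y) k →
    seq (WeightedGraph.walkWeight weightedGraph p) k ≡ fromℕ (len p)
  seq-walkWeight stop k = refl
  seq-walkWeight {x} (_◅_ {j = z} e p) k =
    trans (cong (fromℕ (w x z) ℚ.+_) (seq-walkWeight p k)) (sym (fromℕ-+ (w x z) (len p)))

  -- Edges have positive weight, so the first edge of a walk strictly lowers the remaining budget.
  -- The search therefore recurses on `k`, trying each of the finitely many first steps.
  within? : ∀ k x y → Dec (Σ[ p ∈ Star Edge x y ] len p ≤ k)
  within? k x y = go k (<-wellFounded k) x y
    where
    go : ∀ k → Acc _<_ k → ∀ x y → Dec (Σ[ p ∈ Star Edge x y ] len p ≤ k)
    go k (acc rec) x y with x Finₚ.≟ y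
    ... | yes refl = yes (stop , z≤n)
    ... | no  x≢y  = map′ cons uncons (Finₚ.any? via?)
      where
      Via : Fin n → Set
      -- `w x z ≤ k` is kept separately: with truncated subtraction alone, an edge exceeding the
      -- budget could be followed by the empty walk.
      Via z = Σ[ e ∈ Edge x z ] w x z ≤ k × Σ[ p ∈ Star Edge z y ] len p ≤ k ∸ w x z
      via? : ∀ z → Dec (Via z)
      via? z with 0 ℕₚ.<? w x z | w x z ℕₚ.≤? k
      ... | no ¬e | _     = no λ (e , _) → ¬e e
      ... | yes _ | no ≰  = no λ (_ , ≤k , _) → ≰ ≤k
      ... | yes e | yes ≤k = map′ (λ q → e , ≤k , q) (λ (_ , _ , q) → q)
                               (go (k ∸ w x z) (rec (∸-dec e ≤k)) z y)
        where
        ∸-dec : ∀ {m k} → 0 < m → m ≤ k → k ∸ m < k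
        ∸-dec {suc m} {suc k} (s≤s z≤n) (s≤s _) = s≤s (ℕₚ.m∸n≤m k m)
      cons : (∃[ z ] Via z) → Σ[ p ∈ Star Edge x y ] len p ≤ k
      cons (z , e , ≤k , p , p≤) = e ◅ p , ℕₚ.≤-trans (ℕₚ.+-monoʳ-≤ (w x z) p≤) (ℕₚ.≤-reflexive (ℕₚ.m+[n∸m]≡n ≤k))
      uncons : (Σ[ p ∈ Star Edge x y ] len p ≤ k) → ∃[ z ] Via z
      uncons (stop , _) = contradiction refl x≢y
      uncons (_◅_ {j = z} e p , ≤k) = z , e , ℕₚ.m+n≤o⇒m≤o (w x z) ≤k , p ,
        subst (_≤ k ∸ w x z) (ℕₚ.m+n∸m≡n (w x z) (len p)) (ℕₚ.∸-monoˡ-≤ (w x z) ≤k)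

  module _ (connected : ∀ x y → Star Edge x y) where

    -- The walk is bounded by `m` rather than of length exactly `m`, because this is the predicate
    -- that `within?` decides; minimality forces equality.
    shortest : ∀ x y → ∃[ m ] (Σ[ p ∈ Star Edge x y ] len p ≤ m)
                            × (∀ k → Σ[ p ∈ Star Edge x y ] len p ≤ k → m ≤ k)
    shortest x y = least (λ k → within? k x y) _ (connected x y , ℕₚ.≤-refl)

    distance : Fin n → Fin n → ℕ
    distance x y = proj₁ (shortest x y)

    geodesic : ∀ x y → Star Edge x y
    geodesic x y = proj₁ (proj₁ (proj₂ (shortest x y)))

    geodesic-len : ∀ x y → len (geodesic x y) ≤ distance x y
    geodesic-len x y = proj₂ (proj₁ (proj₂ (shortest x y)))

    distance-min : ∀ {x y} (p : Star Edge x y) → distance x y ≤ len p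
    distance-min {x} {y} p = proj₂ (proj₂ (shortest x y)) (len p) (p , ℕₚ.≤-refl)

    distance-refl : ∀ x → distance x x ≡ 0
    distance-refl x = ℕₚ.n≤0⇒n≡0 (distance-min stop)

    distance-sym : ∀ x y → distance x y ≡ distance y x
    distance-sym x y = ℕₚ.≤-antisym (half x y) (half y x)
      where
      half : ∀ x y → distance x y ≤ distance y x
      half x y = ℕₚ.≤-trans (distance-min (rev (geodesic y x)))
        (ℕₚ.≤-trans (ℕₚ.≤-reflexive (len-rev (geodesic y x))) (geodesic-len y x))

    distance-triangle : ∀ x y z → distance x z ≤ distance x y + distance y z
    distance-triangle x y z = ℕₚ.≤-trans (distance-min (geodesic x y ◅◅ geodesic y z))
      (ℕₚ.≤-trans (ℕₚ.≤-reflexive (len-◅◅ (geodesic x y) (geodesic y z)))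
        (ℕₚ.+-mono-≤ (geodesic-len x y) (geodesic-len y z)))

    distance≡0⇒≡ : ∀ x y → distance x y ≡ 0 → x ≡ y
    distance≡0⇒≡ x y d≡0 = trivial (geodesic x y) (subst (len (geodesic x y) ≤_) d≡0 (geodesic-len x y))
      where
      trivial : ∀ {x y} (p : Star Edge x y) → len p ≤ 0 → x ≡ y
      trivial stop    _   = refl
      trivial {x} (_◅_ {j = z} e p) ≤0 = contradiction (ℕₚ.≤-trans e (ℕₚ.m+n≤o⇒m≤o (w x z) ≤0)) λ ()

    pathMetric : Metric (Fin n)
    pathMetric = record
      { dist = λ x y → fromℚ (fromℕ (distance x y))
      ; isMetric = record
        { isSemiMetric = record
          { isQuasiSemiMetric = record
            { isPreMetric = record
              { isProtoMetric = record
                { isPartialOrder  = ≤ᴿ-isPartialOrder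
                ; ≈-isEquivalence = isEquivalence
                ; cong            = λ { {x} {_} {u} refl refl → ≡⇒≈ᴿ {fromℚ (fromℕ (distance x u))} {fromℚ (fromℕ (distance x u))} λ _ → refl }
                ; nonNegative     = λ {x} {y} → fromℚ-mono-≤ (0≤fromℕ (distance x y))
                }
              ; ≈⇒0 = λ { {x} refl → ≡⇒≈ᴿ {fromℚ (fromℕ (distance x x))} {0ᴿ} λ _ → cong fromℕ (distance-refl x) }
              }
            ; 0⇒≈ = λ {x} {y} d≈0 → distance≡0⇒≡ x y (fromℕ≈0⇒≡0 (distance x y) d≈0)
            }
          ; sym = λ x y → ≡⇒≈ᴿ {fromℚ (fromℕ (distance x y))} {fromℚ (fromℕ (distance y x))}
                    λ _ → cong fromℕ (distance-sym x y)
          }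
        ; triangle = λ x y z → ≤ᴿ-trans {fromℚ (fromℕ (distance x z))} {fromℚ (fromℕ (distance x y + distance y z))}
            {fromℚ (fromℕ (distance x y)) +ᴿ fromℚ (fromℕ (distance y z))}
            (fromℚ-mono-≤ (fromℕ-mono-≤ (distance-triangle x y z)))
            (≈ᴿ⇒≤ᴿ {fromℚ (fromℕ (distance x y + distance y z))}
                    {fromℚ (fromℕ (distance x y)) +ᴿ fromℚ (fromℕ (distance y z))}
              (≡⇒≈ᴿ {fromℚ (fromℕ (distance x y + distance y z))}
                     {fromℚ (fromℕ (distance x y)) +ᴿ fromℚ (fromℕ (distance y z))}
                λ _ → fromℕ-+ (distance x y) (distance y z)))
        }
      }

    -- `distance` minimises over walks, whereas `IsDistance` speaks of paths. Loop erasure of a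
    -- geodesic gives a path that is no longer, and minimality makes its length equal to the
    -- distance.
    pathMetric-induced : Induces weightedGraph pathMetric
    pathMetric-induced x y = (path , ≡⇒≈ᴿ {pathWeight path} {d} λ k →
        trans (seq-walkWeight (proj₁ path) k) (cong fromℕ (ℕₚ.≤-antisym
          (ℕₚ.≤-trans (proj₂ (proj₂ erased) _) (geodesic-len x y)) (distance-min (proj₁ path)))))
      , λ p → ≤ᴿ-trans {d} {fromℚ (fromℕ (len (proj₁ p)))} {pathWeight p}
          (fromℚ-mono-≤ (fromℕ-mono-≤ (distance-min (proj₁ p))))
          (≈ᴿ⇒≤ᴿ {fromℚ (fromℕ (len (proj₁ p)))} {pathWeight p}
            (≡⇒≈ᴿ {fromℚ (fromℕ (len (proj₁ p)))} {pathWeight p} λ k → sym (seq-walkWeight (proj₁ p) k)))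
      where
      open WeightedGraph weightedGraph using (pathWeight)
      d : ℝ
      d = fromℚ (fromℕ (distance x y))
      erased = loop-erasure weightGraph (geodesic x y)
      path : Graph.Path weightGraph x y
      path = proj₁ erased

-- Tree decompositions over rooted trees

-- `rank` need not be the depth; it only has to drop towards the parent. Hence every climb along
-- parents ends, and by `orphan` it ends at `root`.
record RootedTree (T : Set) : Set where
  field
    root    : T
    parent  : T → Maybe T
    rank    : T → ℕ
    orphan  : ∀ i → parent i ≡ nothing → i ≡ root
    rank-<  : ∀ {i j} → parent i ≡ just j → rank j < rank i

-- `b` bounds the bag sizes and is thus one more than the bound on the width. Connectivity of the
-- bags is replaced by the one-step condition `ascend`, which is easily checked when trees are
-- grafted together.
record Decomposition {V : Set} (W : Weighting V) {T : Set} (R : RootedTree T) (b : ℕ) : Set where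
  open Weighting W
  open RootedTree R
  field
    bag          : T → List V
    bag-size     : ∀ k → length (bag k) ≤ b
    edge-in-bag  : ∀ {u v} → Edge u v → ∃[ k ] u ∈ bag k × v ∈ bag k
    top          : V → T
    ∈top         : ∀ v → v ∈ bag (top v)
    -- The nodes whose bags contain v form the subtree below top v.
    ascend       : ∀ {v k} → v ∈ bag k → k ≡ top v ⊎ ∃[ j ] parent k ≡ just j × v ∈ bag j

module _ {m : ℕ} {T : Set} (enum : T ↔ Fin m) (R : RootedTree T) where
  open Inverse enum using (to; from; strictlyInverseˡ; strictlyInverseʳ)
  open RootedTree R

  -- The parent is the first argument. The equation is stated in `Fin m`, where equality is
  -- decidable.
  Child : Fin m → Fin m → Set
  Child j i = Maybe.map to (parent (from i)) ≡ just j

  Child⇒parent : ∀ {i j} → Child j i → parent (from i) ≡ just (from j)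
  Child⇒parent {i} eq with parent (from i)
  Child⇒parent refl | just k = cong just (sym (strictlyInverseʳ k))

  Child-rank : ∀ {i j} → Child j i → rank (from j) < rank (from i)
  Child-rank = rank-< ∘ Child⇒parent

  Child-unique : ∀ {i j k} → Child j i → Child k i → j ≡ k
  Child-unique p q = Maybeₚ.just-injective (trans (sym p) q)

  child? : ∀ j i → Dec (Child j i)
  child? j i = Maybeₚ.≡-dec Finₚ._≟_ _ _

  tree-graph : Graph
  tree-graph = record
    { order    = m
    ; _~_      = λ i j → Child j i ⊎ Child i j
    ; ~-sym    = Sum.swap
    ; ~-irrefl = λ where
        refl (inj₁ c) → ℕₚ.<-irrefl refl (Child-rank c)
        refl (inj₂ c) → ℕₚ.<-irrefl refl (Child-rank c)
    ; _~?_     = λ i j → child? j i ⊎-dec child? i j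
    }

  open Graph tree-graph

  height : Fin m → ℕ
  height = rank ∘ from

  end∈ : ∀ {x y} (p : Walk x y) → y ∈ vertices p
  end∈ stop    = here refl
  end∈ (_ ◅ p) = there (end∈ p)

  All-◅◅ : ∀ {B : Fin m → Set} {x y z} (p : Walk x y) (q : Walk y z) →
           All B (vertices p) → All B (vertices q) → All B (vertices (p ◅◅ q))
  All-◅◅ stop    q _          bq = bq
  All-◅◅ (_ ◅ p) q (b ∷ bp) bq = b ∷ All-◅◅ p q bp bq

  Unique-closed : ∀ {x y} (p : Walk x y) → Unique (vertices p) → x ≡ y → length (vertices p) ≡ 1
  Unique-closed stop    _         _    = refl
  Unique-closed (_ ◅ p) (x∉p ∷ _) refl = contradiction refl (All.lookup x∉p (end∈ p))

  -- Once a path has gone down it cannot turn up again: the only way up leads to the parent it has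
  -- just left, and its vertices are distinct.
  descending : ∀ {x z y} → Child x z → (p : Walk z y) → Unique (x ∷ vertices p) → z ≡ y ⊎ height z < height y
  descending c stop _ = inj₁ refl
  descending c (inj₁ c′ ◅ p) (x∉ ∷ _) =
    contradiction (Child-unique c c′) (All.lookup x∉ (there (start∈ tree-graph p)))
  descending c (inj₂ c′ ◅ p) (_ ∷ u) with descending c′ p u
  ... | inj₁ refl = inj₂ (Child-rank c′)
  ... | inj₂ lt   = inj₂ (ℕₚ.<-trans (Child-rank c′) lt)

  -- Either all edges go up, or the path descends somewhere and then arrives at `y` from its parent.
  -- If the first edge goes down and the rest does not end higher than it starts, `descending`
  -- leaves only the case that the rest is trivial.
  ascending : ∀ {x y} (p : Walk x y) → Unique (vertices p) →
              height y ≤ height x ⊎ ∃[ z ] Child z y × z ∈ vertices p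
  ascending stop _ = inj₁ ℕₚ.≤-refl
  ascending (e ◅ p) u@(_ ∷ u′) with ascending p u′
  ... | inj₂ (z , c , z∈) = inj₂ (z , c , there z∈)
  ascending (inj₁ c ◅ p) _ | inj₁ le = inj₁ (ℕₚ.≤-trans le (ℕₚ.<⇒≤ (Child-rank c)))
  ascending (inj₂ c ◅ p) u | inj₁ le with descending c p u
  ... | inj₁ refl = inj₂ (_ , c , here refl)
  ... | inj₂ lt   = contradiction le (ℕₚ.<⇒≱ lt)

  -- A path in a rooted tree first ascends and then descends, so its ends are
  -- adjacent only if it is a single edge.
  tree-acyclic : Acyclic
  tree-acyclic x y (stop , _) (s≤s ()) _
  tree-acyclic x y (e ◅ p , u@(x∉ ∷ u′)) 3≤ y~x = go e y~x
    where
    ¬closed : ∀ {z} (q : Walk z y) → Unique (vertices q) → 3 ≤ suc (length (vertices q)) → ¬ (z ≡ y)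
    ¬closed q uq 3≤ z≡y with subst (λ l → 3 ≤ suc l) (Unique-closed q uq z≡y) 3≤
    ... | s≤s (s≤s ())
    go : x ~ _ → y ~ x → ⊥
    go (inj₁ x↑z) (inj₂ x↑y) = ¬closed p u′ 3≤ (Child-unique x↑z x↑y)
    go (inj₂ z↑x) (inj₂ x↑y) with descending z↑x p u
    ... | inj₁ z≡y = ¬closed p u′ 3≤ z≡y
    ... | inj₂ lt  = ℕₚ.<-asym (ℕₚ.<-trans (Child-rank z↑x) lt) (Child-rank x↑y)
    go e′ (inj₁ y↑x) with ascending p u′
    ... | inj₂ (w , y↑w , w∈p) = All.lookup x∉ (subst (_∈ vertices p) (Child-unique y↑w y↑x) w∈p) refl
    go (inj₁ x↑z) (inj₁ y↑x) | inj₁ le = ℕₚ.<⇒≱ (ℕₚ.<-trans (Child-rank x↑z) (Child-rank y↑x)) le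
    go (inj₂ z↑x) (inj₁ y↑x) | inj₁ le with descending z↑x p u
    ... | inj₁ z≡y = ¬closed p u′ 3≤ z≡y
    ... | inj₂ lt  = ℕₚ.<⇒≱ lt le

  -- Any two nodes of `B` are joined within `B` by climbing from one to `t` and descending to the
  -- other. With `B` the nodes whose bags contain a vertex this connects the bags; with `B`
  -- everything and `t` the root it connects the tree.
  module Climb {B : Fin m → Set} {t : Fin m}
               (ascend : ∀ {k} → B k → k ≡ t ⊎ ∃[ j ] Child j k × B j) where

    Within : Fin m → Fin m → Set
    Within i j = Σ[ p ∈ Walk i j ] All B (vertices p)

    climb : ∀ i → B i → Within i t × Within t i
    climb i = go i (<-wellFounded (height i))
      where
      go : ∀ i → Acc _<_ (height i) → B i → Within i t × Within t i
      go i (acc rec) b with ascend b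
      ... | inj₁ refl         = (stop , b ∷ []) , (stop , b ∷ [])
      ... | inj₂ (j , c , b′) with go j (rec (Child-rank c)) b′
      ... | (p , bp) , (q , bq) =
        (inj₁ c ◅ p , b ∷ bp) ,
        (q ◅◅ (inj₂ c ◅ stop) , All-◅◅ q (inj₂ c ◅ stop) bq (b′ ∷ b ∷ []))

    path : ∀ i j → B i → B j → Σ[ p ∈ Path i j ] All B (vertices (proj₁ p))
    path i j bi bj with climb i bi | climb j bj
    ... | (p , bp) , _ | _ , (q , bq) with loop-erasure tree-graph (p ◅◅ q)
    ... | r , sub , _ = r , anti-mono sub (All-◅◅ p q bp bq)

  tree-isTree : IsTree
  tree-isTree = inhabited (to root) , (λ i j → proj₁ (Climb.path to-root i j tt tt)) , tree-acyclic
    where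
    inhabited : ∀ {k} → Fin k → 1 ≤ k
    inhabited {suc _} _ = s≤s z≤n
    to-root : ∀ {k} → ⊤ → k ≡ to root ⊎ ∃[ j ] Child j k × ⊤
    to-root {k} _ with parent (from k) in eq
    ... | nothing = inj₁ (trans (sym (strictlyInverseˡ k)) (cong to (orphan (from k) eq)))
    ... | just j  = inj₂ (to j , refl , tt)

-- From bags as lists to bags as subsets

⟦_⟧ : ∀ {n} → List (Fin n) → Subset n
⟦ [] ⟧     = Subset.⊥
⟦ x ∷ xs ⟧ = ⁅ x ⁆ ∪ ⟦ xs ⟧

∈⟦⟧⁺ : ∀ {n} {x : Fin n} {xs} → x ∈ xs → x Subset.∈ ⟦ xs ⟧
∈⟦⟧⁺ (here refl) = Subsetₚ.x∈p∪q⁺ (inj₁ (Subsetₚ.x∈⁅x⁆ _))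
∈⟦⟧⁺ (there x∈)  = Subsetₚ.x∈p∪q⁺ (inj₂ (∈⟦⟧⁺ x∈))

∈⟦⟧⁻ : ∀ {n} {x : Fin n} xs → x Subset.∈ ⟦ xs ⟧ → x ∈ xs
∈⟦⟧⁻ []       x∈ = contradiction x∈ Subsetₚ.∉⊥
∈⟦⟧⁻ (y ∷ xs) x∈ with Subsetₚ.x∈p∪q⁻ ⁅ y ⁆ ⟦ xs ⟧ x∈
... | inj₁ x∈y  = here (Subsetₚ.x∈⁅y⁆⇒x≡y y x∈y)
... | inj₂ x∈xs = there (∈⟦⟧⁻ xs x∈xs)

∣p∪q∣≤∣p∣+∣q∣ : ∀ {n} (p q : Subset n) → ∣ p ∪ q ∣ ≤ ∣ p ∣ + ∣ q ∣
∣p∪q∣≤∣p∣+∣q∣ []          []          = z≤n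
∣p∪q∣≤∣p∣+∣q∣ (true ∷ p)  (true ∷ q)  = s≤s (ℕₚ.≤-trans (∣p∪q∣≤∣p∣+∣q∣ p q) (ℕₚ.+-monoʳ-≤ ∣ p ∣ (ℕₚ.n≤1+n ∣ q ∣)))
∣p∪q∣≤∣p∣+∣q∣ (true ∷ p)  (false ∷ q) = s≤s (∣p∪q∣≤∣p∣+∣q∣ p q)
∣p∪q∣≤∣p∣+∣q∣ (false ∷ p) (true ∷ q)  = ℕₚ.≤-trans (s≤s (∣p∪q∣≤∣p∣+∣q∣ p q)) (ℕₚ.≤-reflexive (sym (ℕₚ.+-suc ∣ p ∣ ∣ q ∣)))
∣p∪q∣≤∣p∣+∣q∣ (false ∷ p) (false ∷ q) = ∣p∪q∣≤∣p∣+∣q∣ p q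

-- Repetitions in a list can only make the subset smaller, which is harmless for an upper bound on
-- the width.
∣⟦⟧∣≤length : ∀ {n} (xs : List (Fin n)) → ∣ ⟦ xs ⟧ ∣ ≤ length xs
∣⟦⟧∣≤length {n} []  = ℕₚ.≤-reflexive (Subsetₚ.∣⊥∣≡0 n)
∣⟦⟧∣≤length (x ∷ xs) = ℕₚ.≤-trans (∣p∪q∣≤∣p∣+∣q∣ ⁅ x ⁆ ⟦ xs ⟧)
  (ℕₚ.+-mono-≤ (ℕₚ.≤-reflexive (Subsetₚ.∣⁅x⁆∣≡1 x)) (∣⟦⟧∣≤length xs))

pullback : ∀ {V : Set} {n} → V ↔ Fin n → Weighting V → Weighting (Fin n)
pullback enum W = record
  { w        = λ i j → w (from i) (from j)
  ; w-sym    = λ i j → w-sym (from i) (from j)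
  ; w-irrefl = λ i → w-irrefl (from i)
  }
  where
  open Inverse enum using (from)
  open Weighting W

module _ {V : Set} {n : ℕ} (venum : V ↔ Fin n) (W : Weighting V)
         {T : Set} {m : ℕ} (tenum : T ↔ Fin m) (R : RootedTree T) {b : ℕ}
         (D : Decomposition W R b) where
  open Decomposition D
  private
    module V = Inverse venum
    module T = Inverse tenum

  bagᶠ : Fin m → Subset n
  bagᶠ i = ⟦ List.map V.to (bag (T.from i)) ⟧

  ∈bagᶠ⁺ : ∀ {v i} → V.from v ∈ bag (T.from i) → v Subset.∈ bagᶠ i
  ∈bagᶠ⁺ {v} {i} v∈ = ∈⟦⟧⁺ {xs = List.map V.to (bag (T.from i))} (subst (_∈ _) (V.strictlyInverseˡ v) (∈-map⁺ V.to v∈))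

  ∈bagᶠ⁺′ : ∀ {v k} → V.from v ∈ bag k → v Subset.∈ bagᶠ (T.to k)
  ∈bagᶠ⁺′ {k = k} v∈ = ∈bagᶠ⁺ (subst (λ j → _ ∈ bag j) (sym (T.strictlyInverseʳ k)) v∈)

  ∈bagᶠ⁻ : ∀ {v} i → v Subset.∈ bagᶠ i → V.from v ∈ bag (T.from i)
  ∈bagᶠ⁻ i v∈ with ∈-map⁻ V.to (∈⟦⟧⁻ (List.map V.to (bag (T.from i))) v∈)
  ... | u , u∈ , refl = subst (_∈ _) (sym (V.strictlyInverseʳ u)) u∈

  treeDecomposition : TreeDecomposition (weightGraph (pullback venum W))
  treeDecomposition = record
    { tree           = tree-graph tenum R
    ; isTree         = tree-isTree tenum R
    ; bag            = bagᶠ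
    ; vertex-covered = λ v → T.to (top (V.from v)) , ∈bagᶠ⁺′ (∈top (V.from v))
    ; edge-covered   = λ e → let k , u∈ , v∈ = edge-in-bag e in T.to k , ∈bagᶠ⁺′ u∈ , ∈bagᶠ⁺′ v∈
    ; bags-connected = λ v i j → Climb.path tenum R (ascendᶠ v) i j
    }
    where
    ascendᶠ : ∀ v {k} → v Subset.∈ bagᶠ k →
      k ≡ T.to (top (V.from v)) ⊎ ∃[ j ] Child tenum R j k × v Subset.∈ bagᶠ j
    ascendᶠ v {k} v∈ with ascend (∈bagᶠ⁻ k v∈)
    ... | inj₁ eq           = inj₁ (trans (sym (T.strictlyInverseˡ k)) (cong T.to eq))
    ... | inj₂ (j , p , v∈j) = inj₂ (T.to j , cong (Maybe.map T.to) p , ∈bagᶠ⁺′ v∈j)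

  width≤ : width treeDecomposition ≤ b ∸ 1
  width≤ = ℕₚ.∸-monoˡ-≤ 1 (max≤v⁺ z≤n (tabulate⁺ λ i →
    ℕₚ.≤-trans (∣⟦⟧∣≤length (List.map V.to (bag (T.from i))))
      (ℕₚ.≤-trans (ℕₚ.≤-reflexive (length-map V.to (bag (T.from i)))) (bag-size (T.from i)))))

-- Ladder gadgets and their composition

map-walk : ∀ {U V : Set} (W : Weighting U) (W′ : Weighting V) (f : U → V) →
  (∀ u v → Weighting.w W′ (f u) (f v) ≡ Weighting.w W u v) →
  ∀ {x y} (p : Star (Weighting.Edge W) x y) →
  Σ[ q ∈ Star (Weighting.Edge W′) (f x) (f y) ] Weighting.len W′ q ≡ Weighting.len W p
map-walk W W′ f eq stop = stop , refl
map-walk W W′ f eq {x} (_◅_ {j = z} e p) with map-walk W W′ f eq p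
... | q , len≡ = subst (0 <_) (sym (eq x z)) e ◅ q , cong₂ _+_ (eq x z) len≡

combine-cancel-< : ∀ {m n} (i j : Fin m) (a c : Fin n) → combine i a Fin.< combine j c →
                   i Fin.< j ⊎ (i ≡ j × a Fin.< c)
combine-cancel-< {n = n} i j a c lt with Finₚ.<-cmp i j
... | tri< i<j _ _ = inj₁ i<j
... | tri> _ _ j<i = contradiction (Finₚ.combine-monoˡ-< c a j<i) (ℕₚ.<-asym lt)
... | tri≈ _ refl _ = inj₂ (refl , ℕₚ.+-cancelˡ-< (n ℕ.* Fin.toℕ i) _ _
        (subst₂ _<_ (Finₚ.toℕ-combine i a) (Finₚ.toℕ-combine i c) lt))

-- `combine` numbers pairs lexicographically and `remQuot` inverts it; this fixes the order of the
-- rungs of a composite ladder.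
remQuot-< : ∀ {m} n (x y : Fin (m ℕ.* n)) → x Fin.< y →
  let (i , a) = remQuot {m} n x ; (j , c) = remQuot {m} n y in
  i Fin.< j ⊎ (i ≡ j × a Fin.< c)
remQuot-< {m} n x y x<y = combine-cancel-< _ _ _ _
  (subst₂ Fin._<_ (sym (Finₚ.combine-remQuot {m} n x)) (sym (Finₚ.combine-remQuot {m} n y)) x<y)

infixr 8 [_]·_

-- A scaled Iverson bracket. As weight zero means non-adjacent, a failing test removes the edge.
[_]·_ : ∀ {A : Set} → Dec A → ℕ → ℕ
[ yes _ ]· c = c
[ no _ ]· c  = 0

[]·-true : ∀ {A : Set} (a? : Dec A) → A → ∀ c → [ a? ]· c ≡ c
[]·-true (yes _) _ _ = refl
[]·-true (no ¬a) a _ = contradiction a ¬a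

[]·-pos : ∀ {A : Set} (a? : Dec A) {c} → 0 < [ a? ]· c → A
[]·-pos (yes a) _ = a

[]·-cong : ∀ {A B : Set} (a? : Dec A) (b? : Dec B) → (A → B) → (B → A) →
           ∀ {c d} → c ≡ d → [ a? ]· c ≡ [ b? ]· d
[]·-cong (yes _) (yes _) _ _ eq = eq
[]·-cong (no _)  (no _)  _ _ _  = refl
[]·-cong (yes a) (no ¬b) f _ _  = contradiction (f a) ¬b
[]·-cong (no ¬a) (yes b) _ g _  = contradiction (g b) ¬a

data Side : Set where
  P X : Side

-- The values of `base` on terminals; their difference `ρ` bounds every P-X distance from below.
level : ℕ → Side → ℕ
level ρ P = 0
level ρ X = ρ

-- `b` bounds the bag sizes, `ρ` is the width and `ℓ` the number of rungs. Upper bounds on distances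
-- are stored as walks and lower bounds as potentials, so the recursion never has to compute a
-- distance.
record Gadget (b ρ ℓ : ℕ) : Set₁ where
  field
    {V}      : Set
    {size}   : ℕ
    V↔       : V ↔ Fin size
    W        : Weighting V
    role     : V → Maybe Side
    terminal : Side → Fin ℓ → V
    role-terminal : ∀ s i → role (terminal s i) ≡ just s

  open Weighting W public

  field
    -- Some rung exists; through it a copy reaches its hubs, which makes a composite connected.
    index₀    : Fin ℓ
    connected : ∀ u v → Star Edge u v
    close     : ∀ {i j} → j Fin.< i → Σ[ p ∈ Star Edge (terminal P j) (terminal X i) ] len p ≤ ρ

    -- A potential for the set of all P-terminals, and one for each P i.  The upper
    -- bounds let the potentials of a copy agree with those of the hubs up to 1.
    base      : V → ℕ
    base-lip  : Lipschitz base
    base-role : ∀ {v s} → role v ≡ just s → base v ≡ level ρ s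

    pot       : Fin ℓ → V → ℕ
    pot-lip   : ∀ i → Lipschitz (pot i)
    pot-≥     : ∀ i {v s} → role v ≡ just s → level ρ s ≤ pot i v
    pot-≤     : ∀ i {v s} → role v ≡ just s → pot i v ≤ 2 + level ρ s
    pot-P     : ∀ i → pot i (terminal P i) ≡ 0
    pot-X     : ∀ i → pot i (terminal X i) ≡ 2 + ρ

    {T}      : Set
    {tsize}  : ℕ
    T↔       : T ↔ Fin tsize
    R        : RootedTree T
    D        : Decomposition W R b

  open RootedTree R public
  open Decomposition D public

  field
    -- A node whose bag holds both ends of the rung. The tree of a copy placed at this rung is
    -- grafted there.
    loc      : Fin ℓ → T
    ∈loc     : ∀ s i → terminal s i ∈ bag (loc i)

  _≟_ : DecidableEquality V
  _≟_ = Finₚ.inj⇒≟ (↔⇒↣ V↔)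

-- The indices are balanced: two hubs raise the bags of `I` to the size `2 + b` allowed in `O`, and
-- two hub edges raise the width of `O` to the width `2 + ρ` of `I`.
module Compose {b ρ m n : ℕ} (O : Gadget (2 + b) ρ m) (I : Gadget b (2 + ρ) n) where
  private
    module O = Gadget O
    module I = Gadget I

  V : Set
  V = O.V ⊎ (Fin m × I.V)

  link : O.V → Fin m → Maybe Side → ℕ
  link u i nothing  = 0
  link u i (just s) = [ u O.≟ O.terminal s i ]· 1

  w : V → V → ℕ
  w (inj₁ u)       (inj₁ v)       = O.w u v
  w (inj₁ u)       (inj₂ (i , v)) = link u i (I.role v)
  w (inj₂ (i , v)) (inj₁ u)       = link u i (I.role v)
  w (inj₂ (i , u)) (inj₂ (j , v)) = [ i Finₚ.≟ j ]· I.w u v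

  w-sym : ∀ x y → w x y ≡ w y x
  w-sym (inj₁ u)       (inj₁ v)       = O.w-sym u v
  w-sym (inj₁ u)       (inj₂ (i , v)) = refl
  w-sym (inj₂ (i , v)) (inj₁ u)       = refl
  w-sym (inj₂ (i , u)) (inj₂ (j , v)) = []·-cong (i Finₚ.≟ j) (j Finₚ.≟ i) sym sym (I.w-sym u v)

  w-copy : ∀ i u v → w (inj₂ (i , u)) (inj₂ (i , v)) ≡ I.w u v
  w-copy i u v = []·-true (i Finₚ.≟ i) refl (I.w u v)

  W : Weighting V
  W = record
    { w        = w
    ; w-sym    = w-sym
    ; w-irrefl = λ where
        (inj₁ u)       → O.w-irrefl u
        (inj₂ (i , u)) → trans (w-copy i u u) (I.w-irrefl u)
    }

  open Weighting W using (Edge; Lipschitz; len; len-◅◅; rev)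

  link≡1 : ∀ {s v} i → I.role v ≡ just s → link (O.terminal s i) i (I.role v) ≡ 1
  link≡1 {s} i eq rewrite eq = []·-true (O.terminal s i O.≟ O.terminal s i) refl 1

  link-inv : ∀ {u i v} → 0 < link u i (I.role v) → ∃[ s ] I.role v ≡ just s × u ≡ O.terminal s i
  link-inv {u} {i} {v} e with I.role v
  ... | just s = s , refl , []·-pos (u O.≟ O.terminal s i) e
  link-inv () | nothing

  copy-inv : ∀ {i j u v} → Edge (inj₂ (i , u)) (inj₂ (j , v)) → i ≡ j
  copy-inv {i} {j} = []·-pos (i Finₚ.≟ j)

  glue : (O.V → ℕ) → (Fin m → I.V → ℕ) → V → ℕ
  glue g k (inj₁ u)       = g u
  glue g k (inj₂ (i , v)) = k i v

  -- Edges inside `O` or inside a copy are covered by the given potentials. A hub edge has weight 1,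
  -- so there it suffices that the two potentials differ by at most 1.
  glue-lip : ∀ {g k} → O.Lipschitz g → (∀ i → I.Lipschitz (k i)) →
    (∀ i {s v} → I.role v ≡ just s → g (O.terminal s i) ≤ 1 + k i v × k i v ≤ 1 + g (O.terminal s i)) →
    Lipschitz (glue g k)
  glue-lip g-lip k-lip near (inj₁ u) (inj₁ v) e = g-lip u v e
  glue-lip g-lip k-lip near (inj₁ u) (inj₂ (i , v)) e with link-inv {u} {i} {v} e
  ... | s , eq , refl rewrite link≡1 {s} {v} i eq = proj₁ (near i eq)
  glue-lip g-lip k-lip near (inj₂ (i , v)) (inj₁ u) e with link-inv {u} {i} {v} e
  ... | s , eq , refl rewrite link≡1 {s} {v} i eq = proj₂ (near i eq)
  glue-lip g-lip k-lip near (inj₂ (i , u)) (inj₂ (j , v)) e with copy-inv {i} {j} {u} {v} e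
  ... | refl rewrite w-copy i u v = k-lip i u v e

  role : V → Maybe Side
  role (inj₁ _)       = nothing
  role (inj₂ (_ , v)) = I.role v

  terminal′ : Side → Fin m × Fin n → V
  terminal′ s (i , a) = inj₂ (i , I.terminal s a)

  hop : ∀ {s v} i → I.role v ≡ just s → Edge (inj₂ (i , v)) (inj₁ (O.terminal s i))
  hop {s} {v} i eq = subst (0 <_) (sym (link≡1 {s} {v} i eq)) (s≤s z≤n)

  outer-walk : ∀ {u v} (p : Star O.Edge u v) → Σ[ q ∈ Star Edge (inj₁ u) (inj₁ v) ] len q ≡ O.len p
  outer-walk = map-walk O.W W inj₁ λ _ _ → refl

  copy-walk : ∀ i {u v} (p : Star I.Edge u v) → Σ[ q ∈ Star Edge (inj₂ (i , u)) (inj₂ (i , v)) ] len q ≡ I.len p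
  copy-walk i = map-walk I.W W (λ v → inj₂ (i , v)) (w-copy i)

  to-hub : ∀ v → Star Edge v (inj₁ (O.terminal P O.index₀))
  to-hub (inj₁ u)       = proj₁ (outer-walk (O.connected u _))
  to-hub (inj₂ (i , v)) = proj₁ (copy-walk i (I.connected v (I.terminal P I.index₀)))
    ◅◅ hop i (I.role-terminal P I.index₀) ◅ proj₁ (outer-walk (O.connected _ _))

  close′ : ∀ {i j a c} → j Fin.< i ⊎ (j ≡ i × c Fin.< a) →
    Σ[ p ∈ Star Edge (terminal′ P (j , c)) (terminal′ X (i , a)) ] len p ≤ 2 + ρ
  close′ {i} {a = a} (inj₂ (refl , c<a)) with I.close c<a
  ... | p , p≤ with copy-walk i p
  ... | q , q≡p = q , subst (_≤ 2 + ρ) (sym q≡p) p≤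
  close′ {i} {j} {a} {c} (inj₁ j<i) with O.close j<i
  ... | p , p≤ with outer-walk p
  ... | q , q≡p = eP ◅ q ◅◅ (eX ◅ stop) , (begin
    w (inj₂ (j , I.terminal P c)) (inj₁ (O.terminal P j)) + len (q ◅◅ (eX ◅ stop))
      ≡⟨ cong₂ _+_ (link≡1 {v = I.terminal P c} j (I.role-terminal P c)) (len-◅◅ q (eX ◅ stop)) ⟩
    1 + (len q + (w (inj₁ (O.terminal X i)) (inj₂ (i , I.terminal X a)) + 0))
      ≡⟨ cong (λ l → 1 + (len q + (l + 0))) (link≡1 {v = I.terminal X a} i (I.role-terminal X a)) ⟩
    1 + (len q + 1)
      ≡⟨ cong suc (ℕₚ.+-comm (len q) 1) ⟩
    2 + len q
      ≤⟨ ℕₚ.+-monoʳ-≤ 2 (subst (_≤ ρ) (sym q≡p) p≤) ⟩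
    2 + ρ ∎)
    where
    open ℕₚ.≤-Reasoning hiding (stop)
    eP = hop j (I.role-terminal P c)
    eX = Weighting.Edge-sym W {inj₂ (i , I.terminal X a)} {inj₁ (O.terminal X i)} (hop i (I.role-terminal X a))

  -- The shift by one centres the hubs: along P-terminal, P-hub, X-hub, X-terminal the values are
  -- `0`, `1`, `1 + ρ`, `2 + ρ`.
  base : V → ℕ
  base = glue (suc ∘ O.base) (λ _ → I.base)

  suc-lip : ∀ {f} → O.Lipschitz f → O.Lipschitz (suc ∘ f)
  suc-lip {f} lip u v e = subst (suc (f u) ≤_) (sym (ℕₚ.+-suc (O.w u v) (f v))) (s≤s (lip u v e))

  base-lip : Lipschitz base
  base-lip = glue-lip (suc-lip O.base-lip) (λ _ → I.base-lip) near
    where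
    near : ∀ i {s v} → I.role v ≡ just s →
      suc (O.base (O.terminal s i)) ≤ 1 + I.base v × I.base v ≤ 2 + O.base (O.terminal s i)
    near i {s} eq rewrite I.base-role eq | O.base-role (O.role-terminal s i) = cases s
      where
      cases : ∀ s → 1 + level ρ s ≤ 1 + level (2 + ρ) s × level (2 + ρ) s ≤ 2 + level ρ s
      cases P = ℕₚ.≤-refl , z≤n
      cases X = s≤s (ℕₚ.m≤n+m ρ 2) , ℕₚ.≤-refl

  -- A P-terminal of O has potential between 0 and 2 with respect to another rung,
  -- so its hub value lies in [1,3] and the constant 2 is within 1 of it.
  away : I.V → ℕ
  away v = I.base v ⊔ 2

  away-lip : I.Lipschitz away
  away-lip u v e = ℕₚ.⊔-lub
    (ℕₚ.≤-trans (I.base-lip u v e) (ℕₚ.+-monoʳ-≤ (I.w u v) (ℕₚ.m≤m⊔n (I.base v) 2)))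
    (ℕₚ.≤-trans (ℕₚ.m≤n⊔m (I.base v) 2) (ℕₚ.m≤n+m (away v) (I.w u v)))

  away-≥ : ∀ {s v} → I.role v ≡ just s → level (2 + ρ) s ≤ away v
  away-≥ {s} {v} eq = subst (_≤ away v) (I.base-role eq) (ℕₚ.m≤m⊔n (I.base v) 2)

  away-P : ∀ {v} → I.role v ≡ just P → away v ≡ 2
  away-P eq rewrite I.base-role eq = refl

  away-X : ∀ {v} → I.role v ≡ just X → away v ≡ 2 + ρ
  away-X eq rewrite I.base-role eq = ℕₚ.m≥n⇒m⊔n≡m (s≤s (s≤s z≤n))

  local : Fin m → Fin n → Fin m → I.V → ℕ
  local i a j with j Finₚ.≟ i
  ... | yes _ = I.pot a
  ... | no  _ = away

  local-self : ∀ i a v → local i a i v ≡ I.pot a v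
  local-self i a v with i Finₚ.≟ i
  ... | yes _  = refl
  ... | no i≢i = contradiction refl i≢i

  pot′ : Fin m × Fin n → V → ℕ
  pot′ (i , a) = glue (suc ∘ O.pot i) (local i a)

  -- In the home copy the hubs have values `1` and `3 + ρ`, the midpoints of the ranges from `0` to
  -- `2` and from `2 + ρ` to `4 + ρ` allowed by `pot-≥` and `pot-≤`. In another copy the roles are
  -- exchanged: the hub values range over `1` to `3` and `1 + ρ` to `3 + ρ`, and `away` takes the
  -- midpoints `2` and `2 + ρ`.
  pot′-lip : ∀ x → Lipschitz (pot′ x)
  pot′-lip (i , a) = glue-lip (suc-lip (O.pot-lip i)) local-lip near
    where
    local-lip : ∀ j → I.Lipschitz (local i a j)
    local-lip j with j Finₚ.≟ i
    ... | yes _ = I.pot-lip a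
    ... | no _  = away-lip
    near : ∀ j {s v} → I.role v ≡ just s →
      suc (O.pot i (O.terminal s j)) ≤ 1 + local i a j v × local i a j v ≤ 2 + O.pot i (O.terminal s j)
    near j {s} eq with j Finₚ.≟ i
    near j {P} eq | yes refl rewrite O.pot-P i = s≤s z≤n , I.pot-≤ a eq
    near j {X} eq | yes refl rewrite O.pot-X i = s≤s (I.pot-≥ a eq) , I.pot-≤ a eq
    near j {P} eq | no _ rewrite away-P eq = s≤s (O.pot-≤ i (O.role-terminal P j)) , s≤s (s≤s z≤n)
    near j {X} eq | no _ rewrite away-X eq =
      s≤s (O.pot-≤ i (O.role-terminal X j)) , s≤s (s≤s (O.pot-≥ i (O.role-terminal X j)))

  pot′-≥ : ∀ x {v s} → role v ≡ just s → level (2 + ρ) s ≤ pot′ x v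
  pot′-≥ (i , a) {inj₂ (j , v)} eq with j Finₚ.≟ i
  ... | yes _ = I.pot-≥ a eq
  ... | no _  = away-≥ eq

  pot′-≤ : ∀ x {v s} → role v ≡ just s → pot′ x v ≤ 2 + level (2 + ρ) s
  pot′-≤ (i , a) {inj₂ (j , v)} eq with j Finₚ.≟ i
  ... | yes _ = I.pot-≤ a eq
  pot′-≤ (i , a) {inj₂ (j , v)} {P} eq | no _ = ℕₚ.≤-reflexive (away-P eq)
  pot′-≤ (i , a) {inj₂ (j , v)} {X} eq | no _ rewrite away-X eq = ℕₚ.m≤n+m (2 + ρ) 2

  T : Set
  T = O.T ⊎ (Fin m × I.T)

  -- The root of a copy's tree is grafted below `O.loc i`. The bag there contains both hubs of the
  -- copy, so the bags containing a hub remain connected.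
  attach : Fin m → Maybe I.T → T
  attach i (just k) = inj₂ (i , k)
  attach i nothing  = inj₁ (O.loc i)

  parent : T → Maybe T
  parent (inj₁ k)       = Maybe.map inj₁ (O.parent k)
  parent (inj₂ (i , k)) = just (attach i (I.parent k))

  rank : T → ℕ
  rank (inj₁ k)       = O.rank k
  -- The offset exceeds the rank of the grafting node, so ranks also drop across the graft.
  rank (inj₂ (i , k)) = suc (O.rank (O.loc i)) + I.rank k

  R : RootedTree T
  R = record
    { root   = inj₁ O.root
    ; parent = parent
    ; rank   = rank
    ; orphan = orphan
    ; rank-< = λ {x} {y} → rank-< x y
    }
    where
    orphan : ∀ x → parent x ≡ nothing → x ≡ inj₁ O.root
    orphan (inj₁ k) eq with O.parent k in eq′
    ... | nothing = cong inj₁ (O.orphan k eq′)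
    rank-< : ∀ x y → parent x ≡ just y → rank y < rank x
    rank-< (inj₁ k) y eq with O.parent k in eq′
    rank-< (inj₁ k) y refl | just j = O.rank-< eq′
    rank-< (inj₂ (i , k)) y refl with I.parent k in eq′
    ... | nothing = s≤s (ℕₚ.m≤m+n _ _)
    ... | just j  = ℕₚ.+-monoʳ-< (suc (O.rank (O.loc i))) (I.rank-< eq′)

  bag : T → List V
  bag (inj₁ k)       = List.map inj₁ (O.bag k)
  bag (inj₂ (i , k)) = inj₁ (O.terminal P i) ∷ inj₁ (O.terminal X i) ∷ List.map (λ v → inj₂ (i , v)) (I.bag k)

  hub∈bag : ∀ s i k → inj₁ (O.terminal s i) ∈ bag (inj₂ (i , k))
  hub∈bag P i k = here refl
  hub∈bag X i k = there (here refl)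

  inner∈bag : ∀ {i v k} → v ∈ I.bag k → inj₂ (i , v) ∈ bag (inj₂ (i , k))
  inner∈bag {i} v∈ = there (there (∈-map⁺ (λ v → inj₂ (i , v)) v∈))

  outer∈bag⁻ : ∀ {u i k} → inj₁ u ∈ bag (inj₂ (i , k)) → ∃[ s ] u ≡ O.terminal s i
  outer∈bag⁻ (here refl)         = P , refl
  outer∈bag⁻ (there (here refl)) = X , refl
  outer∈bag⁻ {i = i} (there (there u∈)) with ∈-map⁻ (λ v → inj₂ (i , v)) u∈
  ... | _ , _ , ()

  D : Decomposition W R (2 + b)
  D = record
    { bag         = bag
    ; bag-size    = λ where
        (inj₁ k)       → subst (_≤ 2 + b) (sym (length-map inj₁ (O.bag k))) (O.bag-size k)
        (inj₂ (i , k)) → s≤s (s≤s (subst (_≤ b) (sym (length-map (λ v → inj₂ (i , v)) (I.bag k))) (I.bag-size k)))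
    ; edge-in-bag = λ {x} {y} → edge-in-bag x y
    ; top         = top
    ; ∈top        = λ where
        (inj₁ u)       → ∈-map⁺ inj₁ (O.∈top u)
        (inj₂ (i , v)) → inner∈bag (I.∈top v)
    ; ascend      = λ {x} {k} → ascend x k
    }
    where
    top : V → T
    top (inj₁ u)       = inj₁ (O.top u)
    top (inj₂ (i , v)) = inj₂ (i , I.top v)

    edge-in-bag : ∀ x y → Edge x y → ∃[ k ] x ∈ bag k × y ∈ bag k
    edge-in-bag (inj₁ u) (inj₁ v) e =
      let k , u∈ , v∈ = O.edge-in-bag e in inj₁ k , ∈-map⁺ inj₁ u∈ , ∈-map⁺ inj₁ v∈
    edge-in-bag (inj₁ u) (inj₂ (i , v)) e with link-inv {u} {i} {v} e
    ... | s , _ , refl = inj₂ (i , I.top v) , hub∈bag s i (I.top v) , inner∈bag (I.∈top v)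
    edge-in-bag (inj₂ (i , v)) (inj₁ u) e with link-inv {u} {i} {v} e
    ... | s , _ , refl = inj₂ (i , I.top v) , inner∈bag (I.∈top v) , hub∈bag s i (I.top v)
    edge-in-bag (inj₂ (i , u)) (inj₂ (j , v)) e with copy-inv {i} {j} {u} {v} e
    ... | refl = let k , u∈ , v∈ = I.edge-in-bag (subst (0 <_) (w-copy i u v) e) in
      inj₂ (i , k) , inner∈bag u∈ , inner∈bag v∈

    ascend : ∀ x k → x ∈ bag k → k ≡ top x ⊎ ∃[ j ] parent k ≡ just j × x ∈ bag j
    ascend (inj₁ u) (inj₁ k) u∈ with ∈-map⁻ inj₁ u∈
    ... | _ , u∈k , refl with O.ascend u∈k
    ... | inj₁ eq           = inj₁ (cong inj₁ eq)
    ... | inj₂ (j , eq , u∈j) = inj₂ (inj₁ j , cong (Maybe.map inj₁) eq , ∈-map⁺ inj₁ u∈j)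
    -- A hub lies in all bags of its copy and, by `∈loc`, in the bag at the graft. Climbing
    -- therefore never loses it, and its top node stays in the tree of `O`.
    ascend (inj₁ u) (inj₂ (i , k)) u∈ with outer∈bag⁻ {i = i} {k} u∈
    ... | s , refl = inj₂ (attach i (I.parent k) , refl , ∈attach (I.parent k))
      where
      ∈attach : ∀ k → inj₁ (O.terminal s i) ∈ bag (attach i k)
      ∈attach (just k) = hub∈bag s i k
      ∈attach nothing  = ∈-map⁺ inj₁ (O.∈loc s i)
    ascend (inj₂ (i , v)) (inj₁ k) v∈ with ∈-map⁻ inj₁ v∈
    ... | _ , _ , ()
    ascend (inj₂ (i , v)) (inj₂ (j , k)) (there (there v∈)) with ∈-map⁻ (λ v → inj₂ (j , v)) v∈
    ... | _ , v∈k , refl with I.ascend v∈k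
    ... | inj₁ eq             = inj₁ (cong (λ k → inj₂ (i , k)) eq)
    ... | inj₂ (l , eq , v∈l) = inj₂ (inj₂ (i , l) , cong (just ∘ attach i) eq , inner∈bag v∈l)

  composite : Gadget (2 + b) (2 + ρ) (m ℕ.* n)
  composite = record
    { V↔            = ↔-sym Finₚ.+↔⊎ ↔-∘ (O.V↔ ⊎-↔ (↔-sym Finₚ.*↔× ↔-∘ (↔-id (Fin m) ×-↔ I.V↔)))
    ; W             = W
    ; role          = role
    ; terminal      = λ s x → terminal′ s (remQuot n x)
    ; role-terminal = λ s x → I.role-terminal s (proj₂ (remQuot {m} n x))
    ; index₀        = combine O.index₀ I.index₀
    ; connected     = λ u v → to-hub u ◅◅ rev (to-hub v)
    ; close         = λ {x} {y} y<x → close′ (remQuot-< n y x y<x)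
    ; base          = base
    ; base-lip      = base-lip
    ; base-role     = λ { {inj₂ (_ , v)} eq → I.base-role eq }
    ; pot           = λ x → pot′ (remQuot n x)
    ; pot-lip       = λ x → pot′-lip (remQuot n x)
    ; pot-≥         = λ x {v} → pot′-≥ (remQuot n x) {v}
    ; pot-≤         = λ x {v} → pot′-≤ (remQuot n x) {v}
    ; pot-P         = λ x → let (i , a) = remQuot {m} n x in trans (local-self i a (I.terminal P a)) (I.pot-P a)
    ; pot-X         = λ x → let (i , a) = remQuot {m} n x in trans (local-self i a (I.terminal X a)) (I.pot-X a)
    ; T↔            = ↔-sym Finₚ.+↔⊎ ↔-∘ (O.T↔ ⊎-↔ (↔-sym Finₚ.*↔× ↔-∘ (↔-id (Fin m) ×-↔ I.T↔)))
    ; R             = R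
    ; D             = D
    ; loc           = λ x → let (i , a) = remQuot {m} n x in inj₂ (i , I.loc a)
    ; ∈loc          = λ s x → inner∈bag (I.∈loc s (proj₂ (remQuot {m} n x)))
    }

-- K₂,₂ with one edge P 0 — X 1 shorter than the others.
module Basic (b ρ : ℕ) where

  V : Set
  V = Side × Fin 2

  -- The width is `2 + ρ`. With two rungs only `P 0` and `X 1` have to be close; every other edge
  -- has the width plus the gap 2.
  w₀ : Fin 2 → Fin 2 → ℕ
  w₀ 0F 1F = 2 + ρ
  w₀ _  _  = 4 + ρ

  w : V → V → ℕ
  w (P , i) (X , j) = w₀ i j
  w (X , j) (P , i) = w₀ i j
  w (P , _) (P , _) = 0
  w (X , _) (X , _) = 0

  W : Weighting V
  W = record
    { w        = w
    ; w-sym    = λ where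
        (P , _) (P , _) → refl
        (P , _) (X , _) → refl
        (X , _) (P , _) → refl
        (X , _) (X , _) → refl
    ; w-irrefl = λ where
        (P , _) → refl
        (X , _) → refl
    }

  open Weighting W using (Edge; Lipschitz; len)

  V↔ : V ↔ Fin 4
  V↔ = mk↔ₛ′
    (λ where (P , 0F) → 0F ; (P , 1F) → 1F ; (X , 0F) → 2F ; (X , 1F) → 3F)
    (λ where 0F → P , 0F ; 1F → P , 1F ; 2F → X , 0F ; 3F → X , 1F)
    (λ where 0F → refl ; 1F → refl ; 2F → refl ; 3F → refl)
    (λ where (P , 0F) → refl ; (P , 1F) → refl ; (X , 0F) → refl ; (X , 1F) → refl)

  2≤w₀ : ∀ i j → 2 ≤ w₀ i j
  2≤w₀ 0F 0F = s≤s (s≤s z≤n)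
  2≤w₀ 0F 1F = s≤s (s≤s z≤n)
  2≤w₀ 1F _  = s≤s (s≤s z≤n)

  PX : ∀ i j → Edge (P , i) (X , j)
  PX i j = ℕₚ.<⇒≤ (2≤w₀ i j)

  XP : ∀ i j → Edge (X , i) (P , j)
  XP i j = PX j i

  PXP : ∀ i j → Star Edge (P , i) (P , j)
  PXP i j = _◅_ {j = X , 0F} (PX i 0F) (XP 0F j ◅ stop)

  to-P0 : ∀ v → Star Edge v (P , 0F)
  to-P0 (P , i) = PXP i 0F
  to-P0 (X , i) = XP i 0F ◅ stop

  from-P0 : ∀ v → Star Edge (P , 0F) v
  from-P0 (P , i) = PXP 0F i
  from-P0 (X , i) = PX 0F i ◅ stop

  close : ∀ {i j} → j Fin.< i → Σ[ p ∈ Star Edge (P , j) (X , i) ] len p ≤ 2 + ρ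
  close {1F} {0F} _ = PX 0F 1F ◅ stop , ℕₚ.≤-reflexive (ℕₚ.+-identityʳ (2 + ρ))
  close {1F} {1F} (s≤s ())

  -- From a P-vertex the inequality is automatic, since its value is at most 2 and every edge weighs
  -- at least 2. Only the direction from X-vertices remains.
  bipartite-lip : ∀ {f} → (∀ i → f (P , i) ≤ 2) → (∀ i j → f (X , j) ≤ w₀ i j + f (P , i)) → Lipschitz f
  bipartite-lip P≤2 X≤ (P , i) (X , j) _ = ℕₚ.≤-trans (P≤2 i) (ℕₚ.≤-trans (2≤w₀ i j) (ℕₚ.m≤m+n _ _))
  bipartite-lip P≤2 X≤ (X , j) (P , i) _ = X≤ i j

  base : V → ℕ
  base (s , _) = level (2 + ρ) s

  2+ρ≤w₀ : ∀ i j → 2 + ρ ≤ w₀ i j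
  2+ρ≤w₀ 0F 0F = ℕₚ.m≤n+m (2 + ρ) 2
  2+ρ≤w₀ 0F 1F = ℕₚ.≤-refl
  2+ρ≤w₀ 1F _  = ℕₚ.m≤n+m (2 + ρ) 2

  -- In `pot 1F` the value 2 at `P 0` compensates for the short edge, which would otherwise force
  -- `X 1` below `4 + ρ`. In `pot 0F` the short edge caps `X 1` at `2 + ρ`.
  pot : Fin 2 → V → ℕ
  pot 0F (P , 0F) = 0
  pot 0F (P , 1F) = 2
  pot 0F (X , 0F) = 4 + ρ
  pot 0F (X , 1F) = 2 + ρ
  pot 1F (P , 0F) = 2
  pot 1F (P , 1F) = 0
  pot 1F (X , 0F) = 2 + ρ
  pot 1F (X , 1F) = 4 + ρ

  pot-bounds : ∀ i s j → level (2 + ρ) s ≤ pot i (s , j) × pot i (s , j) ≤ 2 + level (2 + ρ) s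
  pot-bounds 0F P 0F = z≤n , z≤n
  pot-bounds 0F P 1F = z≤n , ℕₚ.≤-refl
  pot-bounds 0F X 0F = ℕₚ.m≤n+m (2 + ρ) 2 , ℕₚ.≤-refl
  pot-bounds 0F X 1F = ℕₚ.≤-refl , ℕₚ.m≤n+m (2 + ρ) 2
  pot-bounds 1F P 0F = z≤n , ℕₚ.≤-refl
  pot-bounds 1F P 1F = z≤n , z≤n
  pot-bounds 1F X 0F = ℕₚ.≤-refl , ℕₚ.m≤n+m (2 + ρ) 2
  pot-bounds 1F X 1F = ℕₚ.m≤n+m (2 + ρ) 2 , ℕₚ.≤-refl

  pot-lip : ∀ i → Lipschitz (pot i)
  pot-lip k = bipartite-lip (λ i → proj₂ (pot-bounds k P i)) (X≤ k)
    where
    long : ∀ k j c → pot k (X , j) ≤ 4 + ρ + c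
    long k j c = ℕₚ.≤-trans (proj₂ (pot-bounds k X j)) (ℕₚ.m≤m+n (4 + ρ) c)
    X≤ : ∀ k i j → pot k (X , j) ≤ w₀ i j + pot k (P , i)
    X≤ k  0F 0F = long k 0F _
    X≤ k  1F j  = long k j _
    X≤ 0F 0F 1F = ℕₚ.m≤m+n (2 + ρ) 0
    X≤ 1F 0F 1F = ℕₚ.≤-reflexive (ℕₚ.+-comm 2 (2 + ρ))

  R : RootedTree (Fin 2)
  R = record
    { root   = 0F
    ; parent = λ where
        0F → nothing
        1F → just 0F
    ; rank   = Fin.toℕ
    ; orphan = λ { 0F _ → refl ; 1F () }
    ; rank-< = λ { {1F} refl → s≤s z≤n }
    }

  bag : Fin 2 → List V
  bag i = (P , i) ∷ (X , 0F) ∷ (X , 1F) ∷ []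

  X∈bag : ∀ i k → (X , i) ∈ bag k
  X∈bag 0F k = there (here refl)
  X∈bag 1F k = there (there (here refl))

  top : V → Fin 2
  top (P , i) = i
  top (X , _) = 0F

  -- The bags have three elements; `b` is slack that lets the same gadget serve as base case for
  -- every `t`.
  D : Decomposition W R (3 + b)
  D = record
    { bag         = bag
    ; bag-size    = λ _ → ℕₚ.m≤m+n 3 b
    ; edge-in-bag = λ {x} {y} → edge-in-bag x y
    ; top         = top
    ; ∈top        = λ where
        (P , i) → here refl
        (X , i) → X∈bag i 0F
    ; ascend      = λ {x} {k} → ascend x k
    }
    where
    edge-in-bag : ∀ x y → Edge x y → ∃[ k ] x ∈ bag k × y ∈ bag k
    edge-in-bag (P , i) (X , j) _ = i , here refl , X∈bag j i
    edge-in-bag (X , j) (P , i) _ = i , X∈bag j i , here refl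

    ascend : ∀ x k → x ∈ bag k → k ≡ top x ⊎ ∃[ j ] RootedTree.parent R k ≡ just j × x ∈ bag j
    ascend (P , i) k  (here refl)                = inj₁ refl
    ascend (P , i) k  (there (there (there ())))
    ascend (X , i) 0F _                          = inj₁ refl
    ascend (X , i) 1F _                          = inj₂ (0F , refl , X∈bag i 0F)

  gadget : Gadget (3 + b) (2 + ρ) 2
  gadget = record
    { V↔            = V↔
    ; W             = W
    ; role          = λ (s , _) → just s
    ; terminal      = _,_
    ; role-terminal = λ _ _ → refl
    ; index₀        = 0F
    ; connected     = λ u v → to-P0 u ◅◅ from-P0 v
    ; close         = close
    ; base          = base
    ; base-lip      = bipartite-lip (λ _ → z≤n) (λ i j → ℕₚ.≤-trans (2+ρ≤w₀ i j) (ℕₚ.m≤m+n _ _))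
    ; base-role     = λ { refl → refl }
    ; pot           = pot
    ; pot-lip       = pot-lip
    ; pot-≥         = λ { i {s , j} refl → proj₁ (pot-bounds i s j) }
    ; pot-≤         = λ { i {s , j} refl → proj₂ (pot-bounds i s j) }
    ; pot-P         = λ { 0F → refl ; 1F → refl }
    ; pot-X         = λ { 0F → refl ; 1F → refl }
    ; T↔            = mk↔ₛ′ (λ k → k) (λ k → k) (λ _ → refl) (λ _ → refl)
    ; R             = R
    ; D             = D
    ; loc           = λ i → i
    ; ∈loc          = λ where
        P i → here refl
        X i → X∈bag i i
    }

-- The recursion along Pascal's rule

-- Writing the bounds as `3 + t * 2` and `(2 + r) * 2` makes an increment of `t` or `r` add 2 by
-- computation, so the indices of `Compose` match without transport. On the boundary the binomial
-- coefficient is 1, hence the two rungs of the basic gadget.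
build : ∀ t r → ∃[ ℓ ] ℓ ≡ 2 ^ ((t + r) C t) × Gadget (3 + t * 2) ((2 + r) * 2) ℓ
build zero r = 2 , cong (2 ^_) (sym (trans (nCk≡nC[n∸k] {0} {r} z≤n) (nCn≡1 r))) , Basic.gadget 0 (2 + r * 2)
build (suc t) zero = 2
  , cong (2 ^_) (sym (trans (cong (_C suc t) (ℕₚ.+-identityʳ (suc t))) (nCn≡1 (suc t))))
  , Basic.gadget (suc t * 2) 2
build (suc t) (suc r) with build (suc t) r | build t (suc r)
... | m , m≡ , O | n , n≡ , I = m * n , size-eq , Compose.composite O I
  where
  open ≡-Reasoning
  size-eq : m * n ≡ 2 ^ ((suc t + suc r) C suc t)
  size-eq = begin
    m * n                                                   ≡⟨ cong₂ _*_ m≡ n≡ ⟩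
    2 ^ ((suc t + r) C suc t) * 2 ^ ((t + suc r) C t)       ≡⟨ ℕₚ.^-distribˡ-+-* 2 ((suc t + r) C suc t) ((t + suc r) C t) ⟨
    2 ^ ((suc t + r) C suc t + (t + suc r) C t)
      ≡⟨ cong (λ k → 2 ^ (k C suc t + (t + suc r) C t)) (sym (ℕₚ.+-suc t r)) ⟩
    2 ^ ((t + suc r) C suc t + (t + suc r) C t)             ≡⟨ cong (2 ^_) (ℕₚ.+-comm ((t + suc r) C suc t) _) ⟩
    2 ^ ((t + suc r) C t + (t + suc r) C suc t)             ≡⟨ cong (2 ^_) (nCk+nC[k+1]≡[n+1]C[k+1] (t + suc r) t) ⟩
    2 ^ ((suc t + suc r) C suc t)                           ∎

-- From gadgets to ladders in the induced metric

module Realise {b r ℓ : ℕ} (𝒢 : Gadget b ((2 + r) * 2) ℓ) where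
  open Gadget 𝒢
  private module V↔ = Inverse V↔

  ρ : ℕ
  ρ = (2 + r) * 2

  Wᶠ : Weighting (Fin size)
  Wᶠ = pullback V↔ W

  open Weighting Wᶠ using () renaming (Edge to Edgeᶠ; len to lenᶠ; Lipschitz to Lipschitzᶠ)

  to-walk : ∀ {u v} (p : Star Edge u v) → Σ[ q ∈ Star Edgeᶠ (V↔.to u) (V↔.to v) ] lenᶠ q ≡ len p
  to-walk = map-walk W Wᶠ V↔.to λ u v → cong₂ w (V↔.strictlyInverseʳ u) (V↔.strictlyInverseʳ v)

  connectedᶠ : ∀ x y → Star Edgeᶠ x y
  connectedᶠ x y = subst₂ (Star Edgeᶠ) (V↔.strictlyInverseˡ x) (V↔.strictlyInverseˡ y)
    (proj₁ (to-walk (connected (V↔.from x) (V↔.from y))))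

  metric : Metric (Fin size)
  metric = pathMetric Wᶠ connectedᶠ

  d : Fin size → Fin size → ℕ
  d = distance Wᶠ connectedᶠ

  vertexᶠ : Side → Fin ℓ → Fin size
  vertexᶠ s i = V↔.to (terminal s i)

  d≤ρ : ∀ {i j} → j Fin.< i → d (vertexᶠ P j) (vertexᶠ X i) ≤ ρ
  d≤ρ j<i with close j<i
  ... | p , p≤ρ with to-walk p
  ... | q , q≡p = ℕₚ.≤-trans (distance-min Wᶠ connectedᶠ q) (subst (_≤ ρ) (sym q≡p) p≤ρ)

  -- `pot i` falls from `2 + ρ` at `X i` to `0` at `P i`. The potential bounds walks from their
  -- start, so the geodesic is taken from `X i` and symmetry turns it around.
  2+ρ≤d : ∀ i → 2 + ρ ≤ d (vertexᶠ P i) (vertexᶠ X i)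
  2+ρ≤d i = begin
    2 + ρ                                     ≡⟨ pot-X i ⟨
    pot i (terminal X i)                      ≡⟨ cong (pot i) (V↔.strictlyInverseʳ _) ⟨
    f (vertexᶠ X i)                           ≤⟨ Weighting.Lipschitz⇒len Wᶠ lip (geodesic Wᶠ connectedᶠ x p) ⟩
    lenᶠ (geodesic Wᶠ connectedᶠ x p) + f p   ≤⟨ ℕₚ.+-monoˡ-≤ (f p) (geodesic-len Wᶠ connectedᶠ x p) ⟩
    d x p + f p                               ≡⟨ cong (_+_ (d x p)) (trans (cong (pot i) (V↔.strictlyInverseʳ _)) (pot-P i)) ⟩
    d x p + 0                                 ≡⟨ ℕₚ.+-identityʳ _ ⟩
    d x p                                     ≡⟨ distance-sym Wᶠ connectedᶠ x p ⟩
    d p x                                     ∎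
    where
    open ℕₚ.≤-Reasoning
    x = vertexᶠ X i
    p = vertexᶠ P i
    f : Fin size → ℕ
    f v = pot i (V↔.from v)
    lip : Lipschitzᶠ f
    lip u v e = pot-lip i (V↔.from u) (V↔.from v) e

  ladder : ∀ ε → ε <ᴿ fromℚ (+ 1 / (2 + r)) → Ladder metric ε ℓ
  ladder ε ε< = record
    { x         = vertexᶠ X
    ; p         = vertexᶠ P
    ; ϱ         = fromℚ (fromℕ ρ)
    -- All of `ρ` serves as the uniform gap above zero; it computes to `suc (3 + r * 2)`.
    ; ϱ-pos     = fromℕ ρ , 0<fromℕ-suc (3 + r * 2) , 0 , λ _ _ → ℚₚ.≤-reflexive (ℚₚ.+-identityˡ (fromℕ ρ))
    ; close     = λ j<i → fromℚ-mono-≤ (fromℕ-mono-≤ (d≤ρ j<i))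
    -- The width is `2 + r` units of size 2 and the distance at least `3 + r` of them.
    ; separated = λ i → scaled-separation (suc r) 2 ε ε< (s≤s z≤n) (2+ρ≤d i)
    }

theorem1p4 : ∀ (t r : ℕ) → 1 ≤ t → 1 ≤ r →
    ∀ (ε : ℝ) → 0ᴿ <ᴿ ε → ε <ᴿ fromℚ (+ 1 / (2 + r)) →
    Σ[ G ∈ WeightedGraph ] Σ[ M ∈ Metric (Vertex (graph G)) ]
    Induces G M
    × TreewidthAtMost (graph G) (2 * t + 2)
    × ScatterDimensionAtLeast M ε (2 ^ ((t + r) C t))
theorem1p4 t r _ _ ε _ ε< with build t r
... | ℓ , ℓ≡ , 𝒢 =
  weightedGraph Wᶠ , metric , pathMetric-induced Wᶠ connectedᶠ
  -- The bags have at most `3 + t * 2` elements, and the width subtracts one.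
  , (treeDecomposition V↔ W T↔ R D , ℕₚ.≤-trans (width≤ V↔ W T↔ R D) (ℕₚ.≤-reflexive 2+t*2≡2*t+2))
  , ℓ , ladder ε ε< , ℕₚ.≤-reflexive (sym ℓ≡)
  where
  open Gadget 𝒢 using (V↔; W; T↔; R; D)
  open Realise {r = r} 𝒢
  2+t*2≡2*t+2 : 2 + t * 2 ≡ 2 * t + 2
  2+t*2≡2*t+2 = trans (ℕₚ.+-comm 2 (t * 2)) (cong (_+ 2) (ℕₚ.*-comm t 2))
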